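{- The graph ($1$-skeleton) of the $5$-dimensional cube is strongly $4$-ambiguous: there exist two $4$-polytopes $P$ and $Q$ that are not combinatorially equivalent to each other and whose $1$-skeleta are both combinatorially equivalent to the $1$-skeleton of the $5$-cube.
   Context: The $k$-skeleton of a convex polytope is the polytopal complex formed by its faces of dimension at most $k$. Two polytopes or complexes are combinatorially equivalent if their face posets are isomorphic. Let $\mathcal S$ be the common $k$-skeleton (up to combinatorial equivalence) of a $d$-polytope $P$ and a $d'$-polytope $P'$ with $d<d'$. Then $\mathcal S$ is called strongly $d$-ambiguous if there is another $d$-polytope $Q$, not combinatorially equivalent to $P$, whose $k$-skeleton is also combinatorially equivalent to $\mathcal S$. -}

module Defs where

open import Algebra.Bundles using (CommutativeRing)
open import Data.Fin.Base using (Fin; zero; suc; finToFun)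
open import Data.Nat.Base as ℕ using (ℕ; suc)
open import Data.Product.Base using (∃; ∃-syntax; Σ-syntax; _×_; proj₁)
open import Data.Sum.Base using (_⊎_)
open import Data.Vec.Functional using (Vector)
open import Level using (Level; _⊔_) renaming (suc to lsuc)
open import Relation.Binary.Bundles using (Poset)
open import Relation.Binary.Core using (Rel)
open import Relation.Binary.Morphism.Structures using (IsOrderIsomorphism)
open import Relation.Binary.Structures using (IsStrictTotalOrder)
import Relation.Binary.Construct.On as On
open import Relation.Nullary.Negation.Core using (¬_)
open import Relation.Unary using (Pred; _∈_)
open import Relation.Unary.Relation.Binary.Subset using (⊆-poset)
import Algebra.Properties.Monoid.Sum as Sum

-- The library has no real numbers; ℝ enters as an arbitrary Dedekind-complete
-- totally ordered field, which determines it up to unique isomorphism.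
-- The order is classical: it is trichotomous as data.

record CompleteOrderedField (c ℓ₁ ℓ₂ : Level) : Set (lsuc (c ⊔ ℓ₁ ⊔ ℓ₂)) where
  field
    commutativeRing : CommutativeRing c ℓ₁

  open CommutativeRing commutativeRing public

  infix 4 _<_ _≤_

  field
    _<_                : Rel Carrier ℓ₂
    isStrictTotalOrder : IsStrictTotalOrder _≈_ _<_

  _≤_ : Rel Carrier (ℓ₁ ⊔ ℓ₂)
  x ≤ y = x < y ⊎ x ≈ y

  UpperBound : ∀ {ℓ} → Pred Carrier ℓ → Pred Carrier (c ⊔ ℓ₁ ⊔ ℓ₂ ⊔ ℓ)
  UpperBound A b = ∀ x → x ∈ A → x ≤ b

  field
    0≉1     : ¬ (0# ≈ 1#)
    inverse : ∀ x → ¬ (x ≈ 0#) → ∃[ y ] x * y ≈ 1#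
    +-mono  : ∀ x y z → x < y → x + z < y + z
    *-pos   : ∀ x y → 0# < x → 0# < y → 0# < x * y
    sup     : (A : Pred Carrier (c ⊔ ℓ₁ ⊔ ℓ₂)) → ∃ A → ∃ (UpperBound A) →
              ∃[ s ] UpperBound A s × (∀ b → UpperBound A b → s ≤ b)

infix 4 _≅_

_≅_ : ∀ {a b c a′ b′ c′} → Poset a b c → Poset a′ b′ c′ →
      Set (a ⊔ b ⊔ c ⊔ a′ ⊔ b′ ⊔ c′)
A ≅ B = ∃[ f ] IsOrderIsomorphism (Poset._≈_ A) (Poset._≈_ B)
                                  (Poset._≤_ A) (Poset._≤_ B) f

module _ {c ℓ₁ ℓ₂} (ℝ : CompleteOrderedField c ℓ₁ ℓ₂) where

  open CompleteOrderedField ℝ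
  open Sum +-monoid using (sum-syntax)

  private
    L : Level
    L = c ⊔ ℓ₁ ⊔ ℓ₂

  Point : ℕ → Set c
  Point n = Vector Carrier n

  PointSet : ℕ → Set (lsuc L)
  PointSet n = Pred (Point n) L

  dot : ∀ {n} → Point n → Point n → Carrier
  dot {n} a x = ∑[ j < n ] (a j * x j)

  conv : ∀ {m n} → (Fin m → Point n) → PointSet n
  conv {m} v x = Σ[ t ∈ (Fin m → Carrier) ]
    (∀ i → 0# ≤ t i) ×
    (∑[ i < m ] t i) ≈ 1# ×
    (∀ j → x j ≈ ∑[ i < m ] (t i * v i j))

  AffinelyIndependent : ∀ {m n} → (Fin m → Point n) → Set (c ⊔ ℓ₁)
  AffinelyIndependent {m} p = (t : Fin m → Carrier) →
    (∑[ i < m ] t i) ≈ 0# →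
    (∀ j → (∑[ i < m ] (t i * p i j)) ≈ 0#) →
    ∀ i → t i ≈ 0#

  HasIndependent : ∀ {n} → ℕ → PointSet n → Set L
  HasIndependent {n} m A =
    Σ[ p ∈ (Fin m → Point n) ] (∀ i → p i ∈ A) × AffinelyIndependent p

  -- Dimension of the affine hull; the empty set has dimension -1, so it
  -- satisfies DimAtMost k for every k.
  DimAtMost : ∀ {n} → ℕ → PointSet n → Set L
  DimAtMost k A = ¬ HasIndependent (2 ℕ.+ k) A

  HasDim : ∀ {n} → ℕ → PointSet n → Set L
  HasDim d A = HasIndependent (suc d) A × DimAtMost d A

  record Polytope : Set c where
    field
      ambient : ℕ
      size    : ℕ
      points  : Fin size → Point ambient

    body : PointSet ambient
    body = conv points

  open Polytope

  -- The faces are the sets cut out by valid inequalities a · x ≤ b. Taking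
  -- a = 0 gives the improper faces: P itself (b = 0) and ∅ (b = 1).
  record Face (P : Polytope) : Set L where
    field
      normal : Point (ambient P)
      offset : Carrier
      valid  : ∀ x → x ∈ body P → dot normal x ≤ offset

    faceSet : PointSet (ambient P)
    faceSet x = x ∈ body P × dot normal x ≈ offset

  open Face

  -- Two inequalities are the same face when they cut out the same point set.
  facePoset : Polytope → Poset L L L
  facePoset P = On.poset (⊆-poset (Point (ambient P)) L) (faceSet {P})

  skeleton : ℕ → Polytope → Poset L L L
  skeleton k P =
    On.poset (facePoset P) (proj₁ {A = Face P} {B = λ F → DimAtMost k (faceSet F)})

  CombinatoriallyEquivalent : Polytope → Polytope → Set L
  CombinatoriallyEquivalent P Q = facePoset P ≅ facePoset Q

  IsPolytopeOfDim : ℕ → Polytope → Set L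
  IsPolytopeOfDim d P = HasDim d (body P)

  -- S is represented by its face poset.
  StronglyAmbiguous : (k d : ℕ) → Poset L L L → Set L
  StronglyAmbiguous k d S =
    ∃[ P ] ∃[ d′ ] ∃[ P′ ] ∃[ Q ]
      IsPolytopeOfDim d P × IsPolytopeOfDim d′ P′ × d ℕ.< d′ ×
      skeleton k P ≅ S × skeleton k P′ ≅ S ×
      IsPolytopeOfDim d Q × ¬ CombinatoriallyEquivalent P Q × skeleton k Q ≅ S

  bit : Fin 2 → Carrier
  bit zero    = 0#
  bit (suc _) = 1#

  -- conv {0,1}ⁿ; finToFun enumerates all functions Fin n → Fin 2.
  cube : ℕ → Polytope
  cube n = record
    { ambient = n
    ; size    = 2 ℕ.^ n
    ; points  = λ i j → bit (finToFun i j)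
    }

{-# OPTIONS --safe #-}
module Submission where

-- Two 4-polytopes are given by coordinates. Both are the convex hull of points (x , y , ±h , ±h) with
-- (x , y , h) running through 8 points of 3-space. For the first one these are (±2 , ±2 , 1) and
-- (±1 , ±1 , 2), and all facets are 3-cubes. For the second one a vertex is moved until two adjacent
-- facets become one. A face of dimension at most 1 of a polytope is a vertex or an edge, and that the
-- edges are exactly those of the 5-cube is certified by linear functionals exposing the vertices and
-- edges, and by expressions of all other vertices as points of the cone spanned by the edges at a
-- given vertex: a face that contains v and another vertex then contains a neighbour of v.
--
-- In the second polytope, the merged facet contains a vertex and four of its five neighbours. In the
-- first one no proper face does, since the affine relation between a vertex and its neighbours has
-- no vanishing coefficient. An isomorphism of face posets would preserve this property.

open import Defs

import Algebra.Properties.Ring as RingProperties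
import Algebra.Properties.Semiring.Mult as SemiringMult
import Algebra.Properties.Semiring.Sum as SemiringSum
open import Data.Bool.Base using (true; false; if_then_else_; _∧_)
open import Data.Empty using (⊥)
open import Data.Fin using (Fin; zero; suc; toℕ; #_; punchIn; finToFun; funToFin; opposite; remQuot)
import Data.Fin.Base as Fin
import Data.Fin.Properties as Fin
open import Data.Integer.Base as ℤ using (ℤ; +_; -[1+_]; +[1+_]; 0ℤ)
import Data.Integer.Properties as ℤ
open import Data.List.Base as List using (List; concatMap; []; _∷_)
open import Data.Maybe.Base using (Maybe; nothing; just)
open import Data.Nat.Base as ℕ using (ℕ; zero; suc)
import Data.Nat.Properties as ℕ
open import Data.Product.Base using (∃; ∃-syntax; Σ-syntax; _×_; _,_; proj₁; proj₂)
open import Data.Sum.Base using (_⊎_; inj₁; inj₂; [_,_]′)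
open import Data.Vec.Base as Vec using (Vec; lookup; tabulate; allFin; zipWith; replicate; []; _∷_; _∷ʳ_)
open import Data.Vec.Functional using (Vector; insertAt; updateAt)
import Data.Vec.Functional.Properties as Vector
import Data.Vec.Properties as Vec
open import Function.Base using (_∘_; id)
open import Level using (_⊔_) renaming (suc to lsuc)
open import Relation.Binary.Bundles using (Poset)
open import Relation.Binary.Definitions using (tri<; tri≈; tri>)
open import Relation.Binary.Morphism.Structures using (IsOrderIsomorphism)
open import Relation.Binary.PropositionalEquality as ≡ using (_≡_; _≢_)
import Relation.Binary.Reasoning.Setoid as SetoidReasoning
open import Relation.Binary.Structures using (IsStrictTotalOrder)
open import Relation.Nullary using (¬_; Dec; does; yes; no; ¬?; contradiction)
open import Relation.Nullary.Decidable
  using (_×-dec_; _⊎-dec_; _→-dec_; decidable-stable; dec-true; dec-false; from-yes; toWitness)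
open import Relation.Unary using (_∈_)

module ℤSum = SemiringSum ℤ.+-*-semiring

dotℤ : ∀ {n} → (Fin n → ℤ) → (Fin n → ℤ) → ℤ
dotℤ a x = ℤSum.sum (λ j → a j ℤ.* x j)

-- Ordered fields

module OrderedFieldProperties {c ℓ₁ ℓ₂} (ℝ : CompleteOrderedField c ℓ₁ ℓ₂) where

  open CompleteOrderedField ℝ hiding (zero)
  open RingProperties ring
  open SemiringSum semiring public
  open SemiringMult semiring using (×-homo-+) renaming (_×_ to _·_)
  open SetoidReasoning setoid
  module < = IsStrictTotalOrder isStrictTotalOrder

  infix 4 _≟_
  _≟_ : ∀ x y → Dec (x ≈ y)
  _≟_ = <._≟_

  <⇒≉ : ∀ {x y} → x < y → ¬ (x ≈ y)
  <⇒≉ x<y x≈y = <.irrefl x≈y x<y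

  neg-pos : ∀ {x} → x < 0# → 0# < - x
  neg-pos {x} x<0 =
    <.<-respˡ-≈ (-‿inverseʳ x) (<.<-respʳ-≈ (+-identityˡ (- x)) (+-mono x 0# (- x) x<0))

  0<1 : 0# < 1#
  0<1 with <.compare 0# 1#
  ... | tri< 0<1 _ _ = 0<1
  ... | tri≈ _ 0≈1 _ = contradiction 0≈1 0≉1
  ... | tri> _ _ 1<0 = <.<-respʳ-≈ [-1]²≈1 (*-pos _ _ (neg-pos 1<0) (neg-pos 1<0))
    where
    [-1]²≈1 : - 1# * - 1# ≈ 1#
    [-1]²≈1 = begin
      - 1# * - 1#    ≈⟨ -‿distribˡ-* 1# (- 1#) ⟨
      - (1# * - 1#)  ≈⟨ -‿cong (*-identityˡ (- 1#)) ⟩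
      - (- 1#)       ≈⟨ -‿involutive 1# ⟩
      1#             ∎

  ≤-refl : ∀ {x} → x ≤ x
  ≤-refl = inj₂ refl

  ≤-respʳ-≈ : ∀ {x y z} → y ≈ z → x ≤ y → x ≤ z
  ≤-respʳ-≈ y≈z (inj₁ x<y) = inj₁ (<.<-respʳ-≈ y≈z x<y)
  ≤-respʳ-≈ y≈z (inj₂ x≈y) = inj₂ (trans x≈y y≈z)

  0<-+-0≤ : ∀ {x y} → 0# < x → 0# ≤ y → 0# < x + y
  0<-+-0≤ {x} {y} 0<x (inj₁ 0<y) =
    <.trans 0<y (<.<-respˡ-≈ (+-identityˡ y) (+-mono 0# x y 0<x))
  0<-+-0≤ {x} {y} 0<x (inj₂ 0≈y) =
    <.<-respʳ-≈ (trans (sym (+-identityʳ x)) (+-congˡ 0≈y)) 0<x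

  0≤-+ : ∀ {x y} → 0# ≤ x → 0# ≤ y → 0# ≤ x + y
  0≤-+ (inj₁ 0<x) 0≤y = inj₁ (0<-+-0≤ 0<x 0≤y)
  0≤-+ {x} {y} (inj₂ 0≈x) 0≤y =
    ≤-respʳ-≈ (trans (sym (+-identityˡ y)) (+-congʳ 0≈x)) 0≤y

  0≤-* : ∀ {x y} → 0# ≤ x → 0# ≤ y → 0# ≤ x * y
  0≤-* (inj₁ 0<x) (inj₁ 0<y) = inj₁ (*-pos _ _ 0<x 0<y)
  0≤-* {x} {y} (inj₂ 0≈x) _  = inj₂ (trans (sym (zeroˡ y)) (*-congʳ 0≈x))
  0≤-* {x} {y} _ (inj₂ 0≈y)  = inj₂ (trans (sym (zeroʳ x)) (*-congˡ 0≈y))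

  0≤-sum : ∀ {n} {x : Vector Carrier n} → (∀ i → 0# ≤ x i) → 0# ≤ sum x
  0≤-sum {zero}  0≤x = ≤-refl
  0≤-sum {suc n} 0≤x = 0≤-+ (0≤x zero) (0≤-sum (0≤x ∘ suc))

  nonneg-sum≈0 : ∀ {n} {x : Vector Carrier n} → (∀ i → 0# ≤ x i) →
                 sum x ≈ 0# → ∀ i → x i ≈ 0#
  nonneg-sum≈0 {suc n} {x} 0≤x Σx≈0 = λ where
      zero    → x₀≈0
      (suc i) → nonneg-sum≈0 (0≤x ∘ suc) Σtail≈0 i
    where
    x₀≈0 : x zero ≈ 0#
    x₀≈0 with 0≤x zero
    ... | inj₂ 0≈x₀ = sym 0≈x₀
    ... | inj₁ 0<x₀ = contradiction (sym Σx≈0) (<⇒≉ (0<-+-0≤ 0<x₀ (0≤-sum (0≤x ∘ suc))))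
    Σtail≈0 : sum (x ∘ suc) ≈ 0#
    Σtail≈0 = trans (sym (+-identityˡ _)) (trans (+-congʳ (sym x₀≈0)) Σx≈0)

  *-cancelˡ-≈0 : ∀ {x y} → ¬ (x ≈ 0#) → x * y ≈ 0# → y ≈ 0#
  *-cancelˡ-≈0 {x} {y} x≉0 xy≈0 = let x⁻¹ , xx⁻¹≈1 = inverse x x≉0 in begin
    y               ≈⟨ *-identityˡ y ⟨
    1# * y          ≈⟨ *-congʳ xx⁻¹≈1 ⟨
    x * x⁻¹ * y     ≈⟨ *-congʳ (*-comm x x⁻¹) ⟩
    x⁻¹ * x * y     ≈⟨ *-assoc x⁻¹ x y ⟩
    x⁻¹ * (x * y)   ≈⟨ *-congˡ xy≈0 ⟩
    x⁻¹ * 0#        ≈⟨ zeroʳ x⁻¹ ⟩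
    0#              ∎

  ≤⇒0≤- : ∀ {x y} → x ≤ y → 0# ≤ y - x
  ≤⇒0≤- {x} {y} (inj₁ x<y) = inj₁ (<.<-respˡ-≈ (-‿inverseʳ x) (+-mono x y (- x) x<y))
  ≤⇒0≤- {x} {y} (inj₂ x≈y) = inj₂ (trans (sym (-‿inverseʳ x)) (+-congʳ x≈y))

  0≤-⇒≤ : ∀ {x y} → 0# ≤ y - x → x ≤ y
  0≤-⇒≤ {x} {y} (inj₁ 0<y-x) = inj₁
    (<.<-respˡ-≈ (+-identityˡ x) (<.<-respʳ-≈ y-x+x≈y (+-mono 0# (y - x) x 0<y-x)))
    where
    y-x+x≈y : y - x + x ≈ y
    y-x+x≈y = trans (+-assoc y (- x) x) (trans (+-congˡ (-‿inverseˡ x)) (+-identityʳ y))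
  0≤-⇒≤ (inj₂ 0≈y-x) = inj₂ (sym (x∙y⁻¹≈ε⇒x≈y _ _ (sym 0≈y-x)))

  sum-zero : ∀ {n} {x : Vector Carrier n} → (∀ i → x i ≈ 0#) → sum x ≈ 0#
  sum-zero {n} x≈0 = trans (sum-cong-≋ x≈0) (sum-replicate-zero n)

  sum-single : ∀ {n} (x : Vector Carrier n) i → (∀ j → j ≢ i → x j ≈ 0#) → sum x ≈ x i
  sum-single {suc n} x zero    x≈0 =
    trans (+-congˡ (sum-zero {n} (λ j → x≈0 (suc j) λ ()))) (+-identityʳ (x zero))
  sum-single {suc n} x (suc i) x≈0 =
    trans (+-cong (x≈0 zero λ ()) (sum-single (x ∘ suc) i (λ j j≢i → x≈0 (suc j) (j≢i ∘ Fin.suc-injective))))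
          (+-identityˡ (x (suc i)))

  -‿sum : ∀ {n} (x : Vector Carrier n) → sum (λ i → - x i) ≈ - sum x
  -‿sum {zero}  x = sym -0#≈0#
  -‿sum {suc n} x = trans (+-congˡ (-‿sum (x ∘ suc))) (-‿+-comm (x zero) (sum (x ∘ suc)))

  sum-- : ∀ {n} (x y : Vector Carrier n) → sum (λ i → x i - y i) ≈ sum x - sum y
  sum-- x y = trans (∑-distrib-+ x (λ i → - y i)) (+-congˡ (-‿sum y))

  -- The integers in an ordered field

  ι : ℤ → Carrier
  ι (+ n)    = n · 1#
  ι -[1+ n ] = - (suc n · 1#)

  private
    cancel-sucs : ∀ x y → (1# + x) - (1# + y) ≈ x - y
    cancel-sucs x y = begin
      (1# + x) - (1# + y)        ≈⟨ +-congˡ (-‿+-comm 1# y) ⟨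
      (1# + x) + (- 1# - y)      ≈⟨ +-congʳ (+-comm 1# x) ⟩
      (x + 1#) + (- 1# - y)      ≈⟨ +-assoc x 1# _ ⟩
      x + (1# + (- 1# - y))      ≈⟨ +-congˡ (+-assoc 1# (- 1#) (- y)) ⟨
      x + ((1# - 1#) - y)        ≈⟨ +-congˡ (+-congʳ (-‿inverseʳ 1#)) ⟩
      x + (0# - y)               ≈⟨ +-congˡ (+-identityˡ (- y)) ⟩
      x - y                      ∎

  ι-⊖ : ∀ m n → ι (m ℤ.⊖ n) ≈ m · 1# - n · 1#
  ι-⊖ zero    zero    = sym (-‿inverseʳ 0#)
  ι-⊖ zero    (suc n) = sym (+-identityˡ _)
  ι-⊖ (suc m) zero    = sym (trans (+-congˡ -0#≈0#) (+-identityʳ _))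
  ι-⊖ (suc m) (suc n) = begin
    ι (suc m ℤ.⊖ suc n)              ≡⟨ ≡.cong ι (ℤ.[1+m]⊖[1+n]≡m⊖n m n) ⟩
    ι (m ℤ.⊖ n)                      ≈⟨ ι-⊖ m n ⟩
    m · 1# - n · 1#                  ≈⟨ cancel-sucs (m · 1#) (n · 1#) ⟨
    suc m · 1# - suc n · 1#          ∎

  ι-+ : ∀ i j → ι (i ℤ.+ j) ≈ ι i + ι j
  ι-+ (+ m)    (+ n)    = ×-homo-+ 1# m n
  ι-+ (+ m)    -[1+ n ] = ι-⊖ m (suc n)
  ι-+ -[1+ m ] (+ n)    = trans (ι-⊖ n (suc m)) (+-comm _ _)
  ι-+ -[1+ m ] -[1+ n ] = begin
    - (suc (suc (m ℕ.+ n)) · 1#)             ≡⟨ ≡.cong (λ k → - (suc k · 1#)) (ℕ.+-suc m n) ⟨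
    - ((suc m ℕ.+ suc n) · 1#)               ≈⟨ -‿cong (×-homo-+ 1# (suc m) (suc n)) ⟩
    - (suc m · 1# + suc n · 1#)              ≈⟨ -‿+-comm _ _ ⟨
    - (suc m · 1#) - suc n · 1#              ∎

  ι-neg : ∀ i → ι (ℤ.- i) ≈ - ι i
  ι-neg (+ zero)   = sym -0#≈0#
  ι-neg +[1+ n ]   = refl
  ι-neg -[1+ n ]   = sym (-‿involutive _)

  ι-- : ∀ i j → ι (i ℤ.- j) ≈ ι i - ι j
  ι-- i j = trans (ι-+ i (ℤ.- j)) (+-congˡ (ι-neg j))

  private
    ι-*-pos : ∀ m j → ι (+ m ℤ.* j) ≈ ι (+ m) * ι j
    ι-*-pos zero    j = sym (zeroˡ (ι j))
    ι-*-pos (suc m) j = begin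
      ι (+ suc m ℤ.* j)              ≡⟨ ≡.cong ι (ℤ.suc-* (+ m) j) ⟩
      ι (j ℤ.+ + m ℤ.* j)            ≈⟨ ι-+ j (+ m ℤ.* j) ⟩
      ι j + ι (+ m ℤ.* j)            ≈⟨ +-cong (sym (*-identityˡ (ι j))) (ι-*-pos m j) ⟩
      1# * ι j + ι (+ m) * ι j       ≈⟨ distribʳ (ι j) 1# (ι (+ m)) ⟨
      (1# + m · 1#) * ι j            ∎

  ι-* : ∀ i j → ι (i ℤ.* j) ≈ ι i * ι j
  ι-* (+ m)      j = ι-*-pos m j
  ι-* i@(-[1+ m ]) j = begin
    ι (i ℤ.* j)                      ≡⟨ ≡.cong ι (ℤ.neg-distribˡ-* (+ suc m) j) ⟨
    ι (ℤ.- (+ suc m ℤ.* j))          ≈⟨ ι-neg (+ suc m ℤ.* j) ⟩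
    - ι (+ suc m ℤ.* j)              ≈⟨ -‿cong (ι-*-pos (suc m) j) ⟩
    - (ι (+ suc m) * ι j)            ≈⟨ -‿distribˡ-* _ _ ⟩
    ι i * ι j                        ∎

  ι-sum : ∀ {n} (x : Fin n → ℤ) → ι (ℤSum.sum x) ≈ sum (ι ∘ x)
  ι-sum {zero}  x = refl
  ι-sum {suc n} x = trans (ι-+ (x zero) _) (+-congˡ (ι-sum (x ∘ suc)))

  ι-dot : ∀ {n} (a x : Fin n → ℤ) → ι (dotℤ a x) ≈ dot ℝ (ι ∘ a) (ι ∘ x)
  ι-dot a x = trans (ι-sum (λ j → a j ℤ.* x j)) (sum-cong-≋ (λ j → ι-* (a j) (x j)))

  0≤ι+ : ∀ n → 0# ≤ ι (+ n)
  0≤ι+ zero    = ≤-refl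
  0≤ι+ (suc n) = 0≤-+ (inj₁ 0<1) (0≤ι+ n)

  0<ι+ : ∀ n → 0# < ι +[1+ n ]
  0<ι+ n = 0<-+-0≤ 0<1 (0≤ι+ n)

  -- An ordered field has characteristic zero, since positive integers go to positive elements.
  ι≈0⇒≡0 : ∀ i → ι i ≈ 0# → i ≡ 0ℤ
  ι≈0⇒≡0 (+ zero) _   = ≡.refl
  ι≈0⇒≡0 +[1+ n ] ι≈0 = contradiction (sym ι≈0) (<⇒≉ (0<ι+ n))
  ι≈0⇒≡0 -[1+ n ] ι≈0 = contradiction (sym (begin
    ι +[1+ n ]      ≈⟨ -‿involutive _ ⟨
    - ι -[1+ n ]    ≈⟨ -‿cong ι≈0 ⟩
    - 0#            ≈⟨ -0#≈0# ⟩
    0#              ∎)) (<⇒≉ (0<ι+ n))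

  ι-mono-< : ∀ {i j} → i ℤ.< j → 0# < ι j - ι i
  ι-mono-< {i} {j} i<j = <.<-respʳ-≈ (ι-- j i) (0<ι (j ℤ.- i) 0<j-i)
    where
    0<j-i : 0ℤ ℤ.< j ℤ.- i
    0<j-i = ≡.subst (ℤ._< j ℤ.- i) (ℤ.+-inverseʳ i) (ℤ.+-monoˡ-< (ℤ.- i) i<j)
    0<ι : ∀ k → 0ℤ ℤ.< k → 0# < ι k
    0<ι +[1+ n ] _ = 0<ι+ n
    0<ι (+ zero) (ℤ.+<+ ())

-- Affine dependence

module AffineGeometry {c ℓ₁ ℓ₂} (ℝ : CompleteOrderedField c ℓ₁ ℓ₂) where

  open CompleteOrderedField ℝ hiding (zero)
  open RingProperties ring
  open OrderedFieldProperties ℝ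
  open SetoidReasoning setoid

  sum-swap : ∀ {m n} (a : Vector Carrier m) (t : Vector Carrier n) (x : Fin n → Fin m → Carrier) →
             ∑[ j < m ] (a j * (∑[ k < n ] (t k * x k j))) ≈
             ∑[ k < n ] (t k * (∑[ j < m ] (a j * x k j)))
  sum-swap {m} {n} a t x = begin
    ∑[ j < m ] (a j * (∑[ k < n ] (t k * x k j)))
      ≈⟨ sum-cong-≋ {m} (λ j → *-distribˡ-sum {n} (a j) _) ⟩
    ∑[ j < m ] (∑[ k < n ] (a j * (t k * x k j)))
      ≈⟨ ∑-comm {m} {n} _ ⟩
    ∑[ k < n ] (∑[ j < m ] (a j * (t k * x k j)))
      ≈⟨ sum-cong-≋ {n} (λ k → sum-cong-≋ {m} (λ j → x∙yz≈y∙xz (a j) (t k) (x k j))) ⟩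
    ∑[ k < n ] (∑[ j < m ] (t k * (a j * x k j)))
      ≈⟨ sum-cong-≋ {n} (λ k → *-distribˡ-sum {m} (t k) _) ⟨
    ∑[ k < n ] (t k * (∑[ j < m ] (a j * x k j))) ∎
    where
    x∙yz≈y∙xz : ∀ x y z → x * (y * z) ≈ y * (x * z)
    x∙yz≈y∙xz x y z = trans (sym (*-assoc x y z)) (trans (*-congʳ (*-comm x y)) (*-assoc y x z))

  sum-*-- : ∀ {n} (t x y : Vector Carrier n) β →
            ∑[ k < n ] (t k * (x k - y k * β)) ≈
            (∑[ k < n ] (t k * x k)) - (∑[ k < n ] (t k * y k)) * β
  sum-*-- {n} t x y β = begin
    ∑[ k < n ] (t k * (x k - y k * β))
      ≈⟨ sum-cong-≋ {n} (λ k → trans (x[y-z]≈xy-xz (t k) (x k) _)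
                                      (+-congˡ (-‿cong (sym (*-assoc (t k) (y k) β))))) ⟩
    ∑[ k < n ] (t k * x k - t k * y k * β)
      ≈⟨ sum-- {n} _ _ ⟩
    (∑[ k < n ] (t k * x k)) - (∑[ k < n ] (t k * y k * β))
      ≈⟨ +-congˡ (-‿cong (*-distribʳ-sum {n} β _)) ⟨
    (∑[ k < n ] (t k * x k)) - (∑[ k < n ] (t k * y k)) * β ∎

  sum-insertAt : ∀ {n} (t : Vector Carrier n) p u (x : Vector Carrier (suc n)) →
                 sum (λ i → insertAt t p u i * x i) ≈ u * x p + (∑[ k < n ] (t k * x (punchIn p k)))
  sum-insertAt {n} t p u x = trans
    (sum-remove {i = p} (λ i → insertAt t p u i * x i))
    (+-cong (*-congʳ (reflexive (Vector.insertAt-lookup t p u)))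
            (sum-cong-≋ {n} (λ k → *-congʳ (reflexive (Vector.insertAt-punchIn t p u k)))))

  Dependence : ∀ {m n} → (Fin m → Vector Carrier n) → Set (c ⊔ ℓ₁)
  Dependence {m} {n} v = Σ[ t ∈ Vector Carrier m ]
    (Σ[ i ∈ Fin m ] ¬ (t i ≈ 0#)) × (∀ (r : Fin n) → ∑[ i < m ] (t i * v i r) ≈ 0#)

  -- Gaussian elimination. A vector with nonzero first coordinate serves as pivot to clear that
  -- coordinate in the others, and a dependence of the results, one dimension lower, extends to the
  -- pivot. Without a pivot the first coordinate imposes no condition, and one vector is left out.
  dependent : ∀ n (v : Fin (suc n) → Vector Carrier n) → Dependence v
  dependent zero    v = (λ _ → 1#) , (zero , λ 1≈0 → 0≉1 (sym 1≈0)) , λ ()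
  dependent (suc n) v with Fin.any? (λ p → ¬? (v p zero ≟ 0#))
  ... | yes (p , vₚ≉0) =
    t⁺ , (punchIn p (proj₁ t≉0) , t⁺≉0) , λ { zero → first-row ; (suc r) → later-row r }
    where
    α = proj₁ (inverse (v p zero) vₚ≉0)
    β : Fin n → Carrier
    β r = α * v p (suc r)
    v′ : Fin (suc n) → Vector Carrier n
    v′ k r = v (punchIn p k) (suc r) - v (punchIn p k) zero * β r
    ih = dependent n v′
    t = proj₁ ih
    t≉0 = proj₁ (proj₂ ih)
    s = ∑[ k < suc n ] (t k * v (punchIn p k) zero)
    -- The pivot gets the coefficient that the first coordinate forces.
    t⁺ = insertAt t p (- (s * α))
    t⁺≉0 : ¬ (t⁺ (punchIn p (proj₁ t≉0)) ≈ 0#)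
    t⁺≉0 t⁺≈0 = proj₂ t≉0
      (trans (reflexive (≡.sym (Vector.insertAt-punchIn t p _ (proj₁ t≉0)))) t⁺≈0)
    -[sα]x : ∀ x → - (s * α) * x ≈ - (s * (α * x))
    -[sα]x x = trans (sym (-‿distribˡ-* (s * α) x)) (-‿cong (*-assoc s α x))
    first-row : sum (λ i → t⁺ i * v i zero) ≈ 0#
    first-row = begin
      sum (λ i → t⁺ i * v i zero)    ≈⟨ sum-insertAt t p _ (λ i → v i zero) ⟩
      - (s * α) * v p zero + s       ≈⟨ +-congʳ (-[sα]x (v p zero)) ⟩
      - (s * (α * v p zero)) + s     ≈⟨ +-congʳ (-‿cong (*-congˡ
                                          (trans (*-comm α _) (proj₂ (inverse (v p zero) vₚ≉0))))) ⟩
      - (s * 1#) + s                 ≈⟨ +-congʳ (-‿cong (*-identityʳ s)) ⟩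
      - s + s                        ≈⟨ -‿inverseˡ s ⟩
      0#                             ∎
    later-row : ∀ r → sum (λ i → t⁺ i * v i (suc r)) ≈ 0#
    later-row r = begin
      sum (λ i → t⁺ i * v i (suc r))       ≈⟨ sum-insertAt t p _ (λ i → v i (suc r)) ⟩
      - (s * α) * v p (suc r) + tv         ≈⟨ +-congʳ (-[sα]x (v p (suc r))) ⟩
      - (s * β r) + tv                     ≈⟨ +-comm _ tv ⟩
      tv - s * β r                         ≈⟨ sum-*-- t (λ k → v (punchIn p k) (suc r))
                                                        (λ k → v (punchIn p k) zero) (β r) ⟨
      sum (λ k → t k * v′ k r)             ≈⟨ proj₂ (proj₂ ih) r ⟩
      0#                                   ∎
      where tv = ∑[ k < suc n ] (t k * v (punchIn p k) (suc r))
  ... | no ¬pivot =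
    t⁺ , (suc (proj₁ t≉0) , proj₂ t≉0) , λ where
      zero    → sum-zero {x = λ i → t⁺ i * v i zero}
                  (λ i → trans (*-congˡ (column≈0 i)) (zeroʳ (t⁺ i)))
      (suc r) → trans (+-cong (zeroˡ (v zero (suc r))) (proj₂ (proj₂ ih) r)) (+-identityˡ 0#)
    where
    ih = dependent n (λ i r → v (suc i) (suc r))
    t≉0 = proj₁ (proj₂ ih)
    t⁺ : Vector Carrier (suc (suc n))
    t⁺ zero    = 0#
    t⁺ (suc i) = proj₁ ih i
    column≈0 : ∀ i → v i zero ≈ 0#
    column≈0 i = decidable-stable (v i zero ≟ 0#) (λ vᵢ≉0 → ¬pivot (i , vᵢ≉0))

  -- Prefixing a coordinate 1 turns `n + 2` points into vectors of dimension `n + 1`, and a linear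
  -- dependence of these is an affine one of the points.
  dimAtMost-ambient : ∀ {n} (A : PointSet ℝ n) → DimAtMost ℝ n A
  dimAtMost-ambient {n} A (p , _ , independent) =
    let t , (i , tᵢ≉0) , tv≈0 = dependent (suc n) (λ i → λ { zero → 1# ; (suc j) → p i j })
        Σt≈0 = trans (sum-cong-≋ {x = t} (λ i → sym (*-identityʳ (t i)))) (tv≈0 zero)
    in tᵢ≉0 (independent t Σt≈0 (tv≈0 ∘ suc) i)

  slack : ∀ {n} → Point ℝ n → Carrier → Point ℝ n → Carrier
  slack a b x = b - dot ℝ a x

  x-0≈x : ∀ x → x - 0# ≈ x
  x-0≈x x = trans (+-congˡ -0#≈0#) (+-identityʳ x)

  slack-1-0 : ∀ {n} (x : Point ℝ n) → slack (λ _ → 0#) 1# x ≈ 1#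
  slack-1-0 {n} x = trans (+-congˡ (-‿cong (sum-zero {n} (λ j → zeroˡ (x j))))) (x-0≈x 1#)

  slack-combination : ∀ {m n} (a : Point ℝ n) b (t : Vector Carrier m) (x : Fin m → Point ℝ n) →
    ∑[ i < m ] (t i * slack a b (x i)) ≈
    sum t * b - dot ℝ a (λ j → ∑[ i < m ] (t i * x i j))
  slack-combination {m} a b t x = begin
    ∑[ i < m ] (t i * slack a b (x i))
      ≈⟨ sum-cong-≋ {m} (λ i → x[y-z]≈xy-xz (t i) b (dot ℝ a (x i))) ⟩
    ∑[ i < m ] (t i * b - t i * dot ℝ a (x i))
      ≈⟨ sum-- {m} _ _ ⟩
    (∑[ i < m ] (t i * b)) - (∑[ i < m ] (t i * dot ℝ a (x i)))
      ≈⟨ +-cong (*-distribʳ-sum b t) (-‿cong (sum-swap a t x)) ⟨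
    sum t * b - dot ℝ a (λ j → ∑[ i < m ] (t i * x i j)) ∎

  dot-congʳ : ∀ {n} (a : Point ℝ n) {x y : Point ℝ n} → (∀ j → x j ≈ y j) → dot ℝ a x ≈ dot ℝ a y
  dot-congʳ {n} a x≈y = sum-cong-≋ {n} (λ j → *-congˡ (x≈y j))

  dot-zeroʳ : ∀ {n} (a : Point ℝ n) {x : Point ℝ n} → (∀ j → x j ≈ 0#) → dot ℝ a x ≈ 0#
  dot-zeroʳ {n} a x≈0 = sum-zero {n} (λ j → trans (*-congˡ (x≈0 j)) (zeroʳ (a j)))

  slack-relation : ∀ {m n} (a : Point ℝ n) b (t : Vector Carrier m) (x : Fin m → Point ℝ n) →
    sum t ≈ 0# → (∀ j → ∑[ i < m ] (t i * x i j) ≈ 0#) →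
    ∑[ i < m ] (t i * slack a b (x i)) ≈ 0#
  slack-relation {m} a b t x Σt≈0 Σtx≈0 = begin
    ∑[ i < m ] (t i * slack a b (x i))                     ≈⟨ slack-combination a b t x ⟩
    sum t * b - dot ℝ a (λ j → ∑[ i < m ] (t i * x i j))   ≈⟨ +-cong (*-congʳ Σt≈0)
                                                                     (-‿cong (dot-zeroʳ a Σtx≈0)) ⟩
    0# * b - 0#                                            ≈⟨ x-0≈x _ ⟩
    0# * b                                                 ≈⟨ zeroˡ b ⟩
    0#                                                     ∎

  -- Applied to an affine relation, the first functional isolates the first coefficient, because it
  -- vanishes at all later points but not at the first; so that coefficient is zero. Induction
  -- treats the remaining points.
  triangular⇒independent : ∀ {k n} (x : Fin k → Point ℝ n) (a : Fin k → Point ℝ n) (b : Fin k → Carrier) →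
    (∀ i j → i Fin.< j → slack (a i) (b i) (x j) ≈ 0#) →
    (∀ i → ¬ (slack (a i) (b i) (x i) ≈ 0#)) →
    AffinelyIndependent ℝ x
  triangular⇒independent {suc k} x a b above diagonal t Σt≈0 Σtx≈0 = λ where
      zero    → t₀≈0
      (suc i) → triangular⇒independent (x ∘ suc) (a ∘ suc) (b ∘ suc)
        (λ i j i<j → above (suc i) (suc j) (ℕ.s≤s i<j)) (diagonal ∘ suc)
        (t ∘ suc)
        (trans (sym (0+ (sum (t ∘ suc)) t₀≈0)) Σt≈0)
        (λ j → trans (sym (0+ (∑[ i < k ] (t (suc i) * x (suc i) j))
                              (trans (*-congʳ t₀≈0) (zeroˡ (x zero j)))))
                     (Σtx≈0 j))
        i
    where
    0+ : ∀ {y} z → y ≈ 0# → y + z ≈ z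
    0+ z y≈0 = trans (+-congʳ y≈0) (+-identityˡ z)
    s : Fin (suc k) → Carrier
    s j = slack (a zero) (b zero) (x j)
    t₀≈0 : t zero ≈ 0#
    t₀≈0 = *-cancelˡ-≈0 (diagonal zero) (begin
      s zero * t zero                                         ≈⟨ *-comm (s zero) (t zero) ⟩
      t zero * s zero                                         ≈⟨ +-identityʳ _ ⟨
      t zero * s zero + 0#                                    ≈⟨ +-congˡ (sum-zero {k} (λ j →
                                                                   trans (*-congˡ (above zero (suc j) (ℕ.s≤s ℕ.z≤n)))
                                                                         (zeroʳ (t (suc j))))) ⟨
      t zero * s zero + (∑[ j < k ] (t (suc j) * s (suc j)))  ≈⟨ slack-relation (a zero) (b zero) t x Σt≈0 Σtx≈0 ⟩
      0#                                                      ∎)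

  -- Only the weights at `v` and `w` can be nonzero, so three points give three vectors in the
  -- plane, which are dependent. As the weights of each point sum to 1, this yields an affine
  -- relation. The variable `l` keeps the sums from unfolding.
  segment-dependent : ∀ {l m n} (p : Fin m → Point ℝ n) (v w : Fin m)
    (T : Fin l → Vector Carrier m) (x : Fin l → Point ℝ n) → 3 ≡ l →
    (∀ i → sum (T i) ≈ 1#) → (∀ i j → x i j ≈ ∑[ k < m ] (T i k * p k j)) →
    (∀ i k → k ≢ v → k ≢ w → T i k ≈ 0#) →
    ¬ AffinelyIndependent ℝ x
  segment-dependent {l} {m} p v w T x 3≡l ΣT≈1 x≈Tp off independent =
    tᵢ≉0 (independent t Σt≈0 Σtx≈0 i)
    where
    weights : Fin l → Vector Carrier 2
    weights i zero    = T i v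
    weights i (suc _) = T i w
    relation : Dependence weights
    relation = ≡.subst (λ l → (weights : Fin l → Vector Carrier 2) → Dependence weights)
                       3≡l (dependent 2) weights
    t = proj₁ relation
    i = proj₁ (proj₁ (proj₂ relation))
    tᵢ≉0 = proj₂ (proj₁ (proj₂ relation))
    column≈0 : ∀ k → ∑[ i < l ] (t i * T i k) ≈ 0#
    column≈0 k with k Fin.≟ v | k Fin.≟ w
    ... | yes ≡.refl | _          = proj₂ (proj₂ relation) zero
    ... | no _       | yes ≡.refl = proj₂ (proj₂ relation) (suc zero)
    ... | no k≢v     | no k≢w     =
      sum-zero {l} (λ i → trans (*-congˡ (off i k k≢v k≢w)) (zeroʳ (t i)))
    vanishes : ∀ (y : Vector Carrier m) → ∑[ k < m ] (y k * (∑[ i < l ] (t i * T i k))) ≈ 0#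
    vanishes y = sum-zero {m} (λ k → trans (*-congˡ (column≈0 k)) (zeroʳ (y k)))
    Σt≈0 : sum t ≈ 0#
    Σt≈0 = begin
      sum t
        ≈⟨ sum-cong-≋ {l} (λ i → trans (*-congˡ (ΣT≈1 i)) (*-identityʳ (t i))) ⟨
      ∑[ i < l ] (t i * sum (T i))
        ≈⟨ sum-cong-≋ {l} (λ i → *-congˡ (sum-cong-≋ {m} (λ k → *-identityˡ (T i k)))) ⟨
      ∑[ i < l ] (t i * (∑[ k < m ] (1# * T i k)))
        ≈⟨ sum-swap t (λ _ → 1#) (λ k i → T i k) ⟩
      ∑[ k < m ] (1# * (∑[ i < l ] (t i * T i k)))
        ≈⟨ vanishes (λ _ → 1#) ⟩
      0# ∎
    Σtx≈0 : ∀ j → ∑[ i < l ] (t i * x i j) ≈ 0#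
    Σtx≈0 j = begin
      ∑[ i < l ] (t i * x i j)
        ≈⟨ sum-cong-≋ {l} (λ i → *-congˡ (trans (x≈Tp i j) (sum-cong-≋ {m} (λ k → *-comm (T i k) (p k j))))) ⟩
      ∑[ i < l ] (t i * (∑[ k < m ] (p k j * T i k)))
        ≈⟨ sum-swap t (λ k → p k j) (λ k i → T i k) ⟩
      ∑[ k < m ] (p k j * (∑[ i < l ] (t i * T i k)))
        ≈⟨ vanishes (λ k → p k j) ⟩
      0# ∎

  -- Agreement up to `≈`, since the points of `cube` are given by `bit` and not by `ι`.
  Represents : ∀ {m n} → (Fin m → Fin n → ℤ) → (Fin m → Point ℝ n) → Set ℓ₁
  Represents x p = ∀ v j → p v j ≈ ι (x v j)

-- Faces and their vertices

module Faces {c ℓ₁ ℓ₂} (ℝ : CompleteOrderedField c ℓ₁ ℓ₂) (P : Polytope ℝ) where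

  open CompleteOrderedField ℝ hiding (zero)
  open RingProperties ring
  open OrderedFieldProperties ℝ
  open AffineGeometry ℝ
  open SetoidReasoning setoid
  open Polytope P renaming (ambient to n; size to m; points to p)
  open Face

  infix 4 _⊑_
  _⊑_ : Face ℝ P → Face ℝ P → Set (c ⊔ ℓ₁ ⊔ ℓ₂)
  _⊑_ = Poset._≤_ (facePoset ℝ P)

  vertexSlack : Face ℝ P → Fin m → Carrier
  vertexSlack F k = slack (normal F) (offset F) (p k)

  Tight : Face ℝ P → Fin m → Set ℓ₁
  Tight F k = vertexSlack F k ≈ 0#

  tight? : ∀ (F : Face ℝ P) k → Dec (Tight F k)
  tight? F k = vertexSlack F k ≟ 0#

  point∈body : ∀ k → p k ∈ body
  point∈body k = δ , 0≤δ , trans (sum-single δ k δ-off) δ-diagonal , λ j → sym (begin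
    ∑[ i < m ] (δ i * p i j)   ≈⟨ sum-single {m} (λ i → δ i * p i j) k
                                    (λ i i≢k → trans (*-congʳ (δ-off i i≢k)) (zeroˡ (p i j))) ⟩
    δ k * p k j                ≈⟨ *-congʳ δ-diagonal ⟩
    1# * p k j                 ≈⟨ *-identityˡ (p k j) ⟩
    p k j                      ∎)
    where
    δ : Vector Carrier m
    δ i = if does (i Fin.≟ k) then 1# else 0#
    0≤δ : ∀ i → 0# ≤ δ i
    0≤δ i with does (i Fin.≟ k)
    ... | true  = inj₁ 0<1
    ... | false = ≤-refl
    δ-diagonal : δ k ≈ 1#
    δ-diagonal = reflexive (≡.cong (if_then 1# else 0#) (dec-true (k Fin.≟ k) ≡.refl))
    δ-off : ∀ i → i ≢ k → δ i ≈ 0#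
    δ-off i i≢k = reflexive (≡.cong (if_then 1# else 0#) (dec-false (i Fin.≟ k) i≢k))

  slack-convex : ∀ a b x (x∈P : x ∈ body) →
                 ∑[ k < m ] (proj₁ x∈P k * slack a b (p k)) ≈ slack a b x
  slack-convex a b x (t , _ , Σt≈1 , x≈Σtp) = begin
    ∑[ k < m ] (t k * slack a b (p k))                       ≈⟨ slack-combination a b t p ⟩
    sum t * b - dot ℝ a (λ j → ∑[ k < m ] (t k * p k j))     ≈⟨ +-cong (trans (*-congʳ Σt≈1) (*-identityˡ b))
                                                                       (-‿cong (dot-congʳ a (sym ∘ x≈Σtp))) ⟩
    slack a b x                                              ∎

  0≤slack : ∀ (F : Face ℝ P) k → 0# ≤ vertexSlack F k
  0≤slack F k = ≤⇒0≤- (valid F (p k) (point∈body k))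

  face : ∀ a b → (∀ k → 0# ≤ slack a b (p k)) → Face ℝ P
  face a b 0≤s = record
    { normal = a
    ; offset = b
    ; valid  = λ x x∈P@(t , 0≤t , _) →
        0≤-⇒≤ (≤-respʳ-≈ (slack-convex a b x x∈P) (0≤-sum (λ k → 0≤-* (0≤t k) (0≤s k))))
    }

  ∈⇒slack≈0 : ∀ (F : Face ℝ P) x → x ∈ faceSet F → slack (normal F) (offset F) x ≈ 0#
  ∈⇒slack≈0 F x (_ , dot≈b) = trans (+-congˡ (-‿cong dot≈b)) (-‿inverseʳ (offset F))

  tight⇒∈ : ∀ (F : Face ℝ P) k → Tight F k → p k ∈ faceSet F
  tight⇒∈ F k s≈0 = point∈body k , sym (x∙y⁻¹≈ε⇒x≈y _ _ s≈0)

  -- The slack at `x` is zero and is the average of the nonnegative slacks at the generating points.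
  -- Hence each term of the average vanishes, and a nonzero slack has weight zero.
  weight-off-face : ∀ (F : Face ℝ P) x (x∈F : x ∈ faceSet F) k → ¬ Tight F k → proj₁ (proj₁ x∈F) k ≈ 0#
  weight-off-face F x x∈F@(x∈P@(t , 0≤t , _) , _) k loose =
    *-cancelˡ-≈0 loose (trans (*-comm _ (t k))
      (nonneg-sum≈0 (λ k → 0≤-* (0≤t k) (0≤slack F k))
        (trans (slack-convex (normal F) (offset F) x x∈P) (∈⇒slack≈0 F x x∈F)) k))

  ⊑⇒tight : ∀ (F G : Face ℝ P) → F ⊑ G → ∀ k → Tight F k → Tight G k
  ⊑⇒tight F G F⊑G k tight = ∈⇒slack≈0 G (p k) (F⊑G {p k} (tight⇒∈ F k tight))

  -- A point of `F` carries weight only at points tight for `F`. Together with `⊑⇒tight` this turns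
  -- the face order into inclusion of finite vertex sets.
  tight⇒⊑ : ∀ (F G : Face ℝ P) → (∀ k → Tight F k → Tight G k) → F ⊑ G
  tight⇒⊑ F G F⇒G {x} x∈F@(x∈P@(t , _) , _) =
    x∈P , sym (x∙y⁻¹≈ε⇒x≈y _ _ (trans (sym (slack-convex (normal G) (offset G) x x∈P))
                                       (sum-zero {m} ts≈0)))
    where
    ts≈0 : ∀ k → t k * vertexSlack G k ≈ 0#
    ts≈0 k with tight? F k
    ... | yes tight = trans (*-congˡ (F⇒G k tight)) (zeroʳ (t k))
    ... | no  loose = trans (*-congʳ (weight-off-face F x x∈F k loose)) (zeroˡ _)

  dimAtMost-1 : ∀ (F : Face ℝ P) v w → (∀ k → Tight F k → k ≡ v ⊎ k ≡ w) → DimAtMost ℝ 1 (faceSet F)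
  dimAtMost-1 F v w only (x , x∈F , independent) =
    segment-dependent p v w (λ i → proj₁ (proj₁ (x∈F i))) x ≡.refl
      (λ i → proj₁ (proj₂ (proj₂ (proj₁ (x∈F i)))))
      (λ i → proj₂ (proj₂ (proj₂ (proj₁ (x∈F i)))))
      (λ i k k≢v k≢w → weight-off-face F (x i) (x∈F i) k
        ([ k≢v , k≢w ]′ ∘ only k))
      independent

  emptyFace : Face ℝ P
  emptyFace = face (λ _ → 0#) 1# (λ k → ≤-respʳ-≈ (sym (slack-1-0 (p k))) (inj₁ 0<1))

  emptyFace-empty : ∀ x → ¬ (x ∈ faceSet emptyFace)
  emptyFace-empty x x∈∅ = 0≉1 (trans (sym (∈⇒slack≈0 emptyFace x x∈∅)) (slack-1-0 x))

  emptyFace-loose : ∀ k → ¬ Tight emptyFace k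
  emptyFace-loose k tight = emptyFace-empty (p k) (tight⇒∈ emptyFace k tight)

-- Polytopes with a given graph

-- Index zero is `v` itself, so that a vertex counts as a degenerate edge and both are handled at
-- once.
star : ∀ {m k} → (Fin m → Fin k → Fin m) → Fin m → Fin (suc k) → Fin m
star nbr v zero    = v
star nbr v (suc i) = nbr v i

-- The possible vertex sets of a face of dimension at most one; nothing is the empty one.
module Shapes {m k} (nbr : Fin m → Fin k → Fin m) where

  Shape : Set
  Shape = Maybe (Fin m × Fin (suc k))

  infix 4 _∈ₛ_
  _∈ₛ_ : Fin m → Shape → Set
  u ∈ₛ nothing      = ⊥
  u ∈ₛ just (v , i) = u ≡ v ⊎ u ≡ star nbr v i

-- Cells stand for faces and Tight for incidence with vertices. A face is determined by its vertices,
-- so that the face order is _≼_.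
record FaceIncidence {m k} (nbr : Fin m → Fin k → Fin m) f ℓ : Set (lsuc (f ⊔ ℓ)) where
  field
    Cell             : Set f
    Tight            : Cell → Fin m → Set ℓ
    tight?           : ∀ F u → Dec (Tight F u)
    starFace         : Fin m → Fin (suc k) → Cell
    starFace-tight   : ∀ v i u → u ≡ v ⊎ u ≡ star nbr v i → Tight (starFace v i) u
    starFace-tight⁻¹ : ∀ v i u → Tight (starFace v i) u → u ≡ v ⊎ u ≡ star nbr v i
    tight-neighbour  : ∀ F v w → Tight F v → Tight F w → w ≢ v → ∃[ i ] Tight F (nbr v i)

  infix 4 _≼_
  _≼_ : Cell → Cell → Set ℓ
  F ≼ G = ∀ u → Tight F u → Tight G u

  ≼-trans : ∀ {F G H} → F ≼ G → G ≼ H → F ≼ H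
  ≼-trans F≼G G≼H u = G≼H u ∘ F≼G u

  vertexFace : Fin m → Cell
  vertexFace v = starFace v zero

  vertexFace-tight : ∀ v → Tight (vertexFace v) v
  vertexFace-tight v = starFace-tight v zero v (inj₁ ≡.refl)

  vertexFace-tight⁻¹ : ∀ v u → Tight (vertexFace v) u → u ≡ v
  vertexFace-tight⁻¹ v u tight = [ id , id ]′ (starFace-tight⁻¹ v zero u tight)

  starFace-tight-self : ∀ v i → Tight (starFace v i) v
  starFace-tight-self v i = starFace-tight v i v (inj₁ ≡.refl)

  starFace-tight-star : ∀ v i → Tight (starFace v i) (star nbr v i)
  starFace-tight-star v i = starFace-tight v i _ (inj₂ ≡.refl)

  starFace-≼ : ∀ {F v i} → Tight F v → Tight F (star nbr v i) → starFace v i ≼ F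
  starFace-≼ {v = v} {i} tight-v tight-s u tight-u with starFace-tight⁻¹ v i u tight-u
  ... | inj₁ ≡.refl = tight-v
  ... | inj₂ ≡.refl = tight-s

  vertexFace-≼ : ∀ {F v} → Tight F v → vertexFace v ≼ F
  vertexFace-≼ tight-v = starFace-≼ tight-v tight-v

  ≼-vertexFace? : ∀ F v → (∃[ u ] Tight F u × u ≢ v) ⊎ F ≼ vertexFace v
  ≼-vertexFace? F v with Fin.any? (λ u → tight? F u ×-dec ¬? (u Fin.≟ v))
  ... | yes found = inj₁ found
  ... | no none   = inj₂ λ u tight-u → starFace-tight v zero u
    (inj₁ (decidable-stable (u Fin.≟ v) (λ u≢v → none (u , tight-u , u≢v))))

-- An integral polytope of dimension n with the graph given by nbr, together with integer data that
-- prove this.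
record GraphRealization {m k} (nbr : Fin m → Fin k → Fin m) (n : ℕ) : Set where
  field
    vertex : Fin m → Fin n → ℤ

    -- starNormal v i exposes {v} (i = zero) or the edge from v to its i-th neighbour.
    starNormal        : Fin m → Fin (suc k) → Fin n → ℤ
    starNormal-tight  : ∀ v i → dotℤ (starNormal v i) (vertex (star nbr v i)) ≡ dotℤ (starNormal v i) (vertex v)
    starNormal-strict : ∀ v i u → u ≡ v ⊎ u ≡ star nbr v i ⊎
                    dotℤ (starNormal v i) (vertex u) ℤ.< dotℤ (starNormal v i) (vertex v)

    -- Every vertex lies in the cone at v spanned by the edges to the neighbours of v.
    scale   : Fin m → Fin m → ℕ
    coeff   : Fin m → Fin m → Fin k → ℕ
    cone    : ∀ v w j → + suc (scale v w) ℤ.* (vertex w j ℤ.- vertex v j) ≡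
              ℤSum.sum (λ i → + coeff v w i ℤ.* (vertex (nbr v i) j ℤ.- vertex v j))
    coeff≢0 : ∀ v w → w ≡ v ⊎ ∃[ i ] coeff v w i ≢ 0

    simplex          : Fin (suc n) → Fin m
    simplexNormal    : Fin (suc n) → Fin n → ℤ
    simplexOffset    : Fin (suc n) → ℤ
    simplex-above    : ∀ i j → i Fin.< j → dotℤ (simplexNormal i) (vertex (simplex j)) ≡ simplexOffset i
    simplex-diagonal : ∀ i → dotℤ (simplexNormal i) (vertex (simplex i)) ≢ simplexOffset i

-- Faces of a polytope with a certified graph

module RealizedFaces {c ℓ₁ ℓ₂} (ℝ : CompleteOrderedField c ℓ₁ ℓ₂)
  {m k n} {nbr : Fin m → Fin k → Fin m} (nbr≢ : ∀ v i → nbr v i ≢ v) (R : GraphRealization nbr n)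
  (p : Fin m → Point ℝ n) (p≈ι : AffineGeometry.Represents ℝ (GraphRealization.vertex R) p) where

  open CompleteOrderedField ℝ hiding (zero)
  open RingProperties ring
  open OrderedFieldProperties ℝ
  open AffineGeometry ℝ
  open SetoidReasoning setoid
  open GraphRealization R

  P : Polytope ℝ
  P = record { ambient = n ; size = m ; points = p }

  open Faces ℝ P public
  open Face

  slack≈ι : ∀ a b v → slack (ι ∘ a) (ι b) (p v) ≈ ι b - ι (dotℤ a (vertex v))
  slack≈ι a b v = +-congˡ (-‿cong (trans (dot-congʳ (ι ∘ a) (p≈ι v)) (sym (ι-dot a (vertex v)))))

  slack≈0 : ∀ a b v → dotℤ a (vertex v) ≡ b → slack (ι ∘ a) (ι b) (p v) ≈ 0#
  slack≈0 a b v ≡.refl = trans (slack≈ι a b v) (-‿inverseʳ (ι b))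

  slack≉0 : ∀ a b v → dotℤ a (vertex v) ≢ b → ¬ (slack (ι ∘ a) (ι b) (p v) ≈ 0#)
  slack≉0 a b v a∙v≢b s≈0 = a∙v≢b (≡.sym (ℤ.i-j≡0⇒i≡j b _
    (ι≈0⇒≡0 _ (trans (ι-- b _) (trans (sym (slack≈ι a b v)) s≈0)))))

  0<slack : ∀ a b v → dotℤ a (vertex v) ℤ.< b → 0# < slack (ι ∘ a) (ι b) (p v)
  0<slack a b v a∙v<b = <.<-respʳ-≈ (sym (slack≈ι a b v)) (ι-mono-< a∙v<b)

  hasDim : HasDim ℝ n (Polytope.body P)
  hasDim = (p ∘ simplex , point∈body ∘ simplex ,
      triangular⇒independent (p ∘ simplex) (λ i → ι ∘ simplexNormal i) (ι ∘ simplexOffset)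
        (λ i j i<j → slack≈0 (simplexNormal i) (simplexOffset i) (simplex j) (simplex-above i j i<j))
        (λ i → slack≉0 (simplexNormal i) (simplexOffset i) (simplex i) (simplex-diagonal i)))
    , dimAtMost-ambient (Polytope.body P)

  latticeFace : ∀ a b → (∀ u → dotℤ a (vertex u) ≡ b ⊎ dotℤ a (vertex u) ℤ.< b) → Face ℝ P
  latticeFace a b valid = face (ι ∘ a) (ι b) λ u →
    [ inj₂ ∘ sym ∘ slack≈0 a b u , inj₁ ∘ 0<slack a b u ]′ (valid u)

  starFace : Fin m → Fin (suc k) → Face ℝ P
  starFace v i = latticeFace (starNormal v i) (dotℤ (starNormal v i) (vertex v)) λ u →
    [ (λ { ≡.refl → inj₁ ≡.refl }) , [ (λ { ≡.refl → inj₁ (starNormal-tight v i) }) , inj₂ ]′ ]′ (starNormal-strict v i u)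

  starFace-tight : ∀ v i u → u ≡ v ⊎ u ≡ star nbr v i → Tight (starFace v i) u
  starFace-tight v i .v (inj₁ ≡.refl) = slack≈0 (starNormal v i) _ v ≡.refl
  starFace-tight v i u  (inj₂ ≡.refl) = slack≈0 (starNormal v i) _ u (starNormal-tight v i)

  starFace-tight⁻¹ : ∀ v i u → Tight (starFace v i) u → u ≡ v ⊎ u ≡ star nbr v i
  starFace-tight⁻¹ v i u tight with starNormal-strict v i u
  ... | inj₁ u≡v          = inj₁ u≡v
  ... | inj₂ (inj₁ u≡s)   = inj₂ u≡s
  ... | inj₂ (inj₂ a∙u<b) = contradiction (sym tight) (<⇒≉ (0<slack (starNormal v i) _ u a∙u<b))

  vertexFace : Fin m → Face ℝ P
  vertexFace v = starFace v zero

  vertexFace-tight⁻¹ : ∀ v u → Tight (vertexFace v) u → u ≡ v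
  vertexFace-tight⁻¹ v u tight = [ id , id ]′ (starFace-tight⁻¹ v zero u tight)

  -- For `v` on `F`, the slack at `x` is minus the linear functional of `F` at `x - v`, so linear
  -- relations between differences carry over to slacks.
  tight-combination : ∀ {l} (F : Face ℝ P) v w d (z : Fin l → ℤ) (u : Fin l → Fin m) →
    (∀ j → d ℤ.* (vertex w j ℤ.- vertex v j) ≡
           ℤSum.sum (λ i → z i ℤ.* (vertex (u i) j ℤ.- vertex v j))) →
    Tight F v → ι d * vertexSlack F w ≈ ∑[ i < l ] (ι (z i) * vertexSlack F (u i))
  tight-combination {l} F v w d z u relation tight = begin
    ι d * vertexSlack F w                         ≈⟨ scaled d w ⟩
    - (ι d * dot ℝ a (difference w))              ≈⟨ -‿cong dot-scale ⟩
    - dot ℝ a (λ j → ι d * difference w j)        ≈⟨ -‿cong (dot-congʳ a relation′) ⟩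
    - dot ℝ a (λ j → ∑[ i < l ] (ι (z i) * difference (u i) j))
                                                  ≈⟨ -‿cong (sum-swap a (ι ∘ z) (difference ∘ u)) ⟩
    - (∑[ i < l ] (ι (z i) * dot ℝ a (difference (u i))))
                                                  ≈⟨ -‿sum {l} _ ⟨
    ∑[ i < l ] (- (ι (z i) * dot ℝ a (difference (u i))))
                                                  ≈⟨ sum-cong-≋ {l} (λ i → scaled (z i) (u i)) ⟨
    ∑[ i < l ] (ι (z i) * vertexSlack F (u i))    ∎
    where
    a = normal F
    difference : Fin m → Point ℝ n
    difference x j = p x j - p v j
    vertexSlack≈ : ∀ x → vertexSlack F x ≈ - dot ℝ a (difference x)
    vertexSlack≈ x = begin
      offset F - dot ℝ a (p x)              ≈⟨ +-congʳ (x∙y⁻¹≈ε⇒x≈y _ _ tight) ⟩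
      dot ℝ a (p v) - dot ℝ a (p x)         ≈⟨ ⁻¹-anti-homo-// _ _ ⟨
      - (dot ℝ a (p x) - dot ℝ a (p v))     ≈⟨ -‿cong (sum-- {n} _ _) ⟨
      - (∑[ j < n ] (a j * p x j - a j * p v j))
                                            ≈⟨ -‿cong (sum-cong-≋ {n} (λ j → x[y-z]≈xy-xz (a j) (p x j) (p v j))) ⟨
      - dot ℝ a (difference x)              ∎
    scaled : ∀ e x → ι e * vertexSlack F x ≈ - (ι e * dot ℝ a (difference x))
    scaled e x = trans (*-congˡ (vertexSlack≈ x)) (sym (-‿distribʳ-* (ι e) _))
    dot-scale : ι d * dot ℝ a (difference w) ≈ dot ℝ a (λ j → ι d * difference w j)
    dot-scale = trans (*-distribˡ-sum {n} (ι d) _) (sum-cong-≋ {n} (λ j →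
      trans (sym (*-assoc (ι d) (a j) _)) (trans (*-congʳ (*-comm (ι d) (a j))) (*-assoc (a j) (ι d) _))))
    ι-difference : ∀ e x j → ι (e ℤ.* (vertex x j ℤ.- vertex v j)) ≈ ι e * difference x j
    ι-difference e x j = trans (ι-* e _) (*-congˡ (trans (ι-- (vertex x j) (vertex v j))
      (sym (+-cong (p≈ι x j) (-‿cong (p≈ι v j))))))
    relation′ : ∀ j → ι d * difference w j ≈ ∑[ i < l ] (ι (z i) * difference (u i) j)
    relation′ j = begin
      ι d * difference w j                                ≈⟨ ι-difference d w j ⟨
      ι (d ℤ.* (vertex w j ℤ.- vertex v j))               ≡⟨ ≡.cong ι (relation j) ⟩
      ι (ℤSum.sum (λ i → z i ℤ.* (vertex (u i) j ℤ.- vertex v j)))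
                                                          ≈⟨ ι-sum {l} _ ⟩
      ∑[ i < l ] ι (z i ℤ.* (vertex (u i) j ℤ.- vertex v j))
                                                          ≈⟨ sum-cong-≋ {l} (λ i → ι-difference (z i) (u i) j) ⟩
      ∑[ i < l ] (ι (z i) * difference (u i) j)           ∎

  tight-cone : ∀ F v w → Tight F v →
    ι (+ suc (scale v w)) * vertexSlack F w ≈ ∑[ i < k ] (ι (+ coeff v w i) * vertexSlack F (nbr v i))
  tight-cone F v w = tight-combination F v w (+ suc (scale v w)) (λ i → + coeff v w i) (nbr v) (cone v w)

  -- The cone relation writes a multiple of the slack at `w`, which is zero, as a sum of nonnegative
  -- terms. Each term vanishes, and since `w` is not `v`, some neighbour enters with a nonzero
  -- coefficient.
  tight-neighbour : ∀ F v w → Tight F v → Tight F w → w ≢ v → ∃[ i ] Tight F (nbr v i)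
  tight-neighbour F v w tight-v tight-w w≢v with coeff≢0 v w
  ... | inj₁ w≡v       = contradiction w≡v w≢v
  ... | inj₂ (i , c≢0) = i , *-cancelˡ-≈0 (c≢0 ∘ ℤ.+-injective ∘ ι≈0⇒≡0 (+ coeff v w i))
    (nonneg-sum≈0 (λ i → 0≤-* (0≤ι+ (coeff v w i)) (0≤slack F (nbr v i)))
      (trans (sym (tight-cone F v w tight-v)) (trans (*-congˡ tight-w) (zeroʳ _))) i)

  tight-star⇒tight : ∀ F v → Tight F v → (∀ i → Tight F (nbr v i)) → ∀ w → Tight F w
  tight-star⇒tight F v tight-v tight-nbr w = *-cancelˡ-≈0 (λ d≈0 → <⇒≉ (0<ι+ (scale v w)) (sym d≈0))
    (trans (tight-cone F v w tight-v) (sum-zero {k} (λ i → trans (*-congˡ (tight-nbr i)) (zeroʳ _))))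

  incidence : FaceIncidence nbr (c ⊔ ℓ₁ ⊔ ℓ₂) ℓ₁
  incidence = record
    { Cell             = Face ℝ P
    ; Tight            = Tight
    ; tight?           = tight?
    ; starFace         = starFace
    ; starFace-tight   = starFace-tight
    ; starFace-tight⁻¹ = starFace-tight⁻¹
    ; tight-neighbour  = tight-neighbour
    }

  -- A relation between the edges at `v` without zero coefficients forces the slack at the remaining
  -- neighbour to vanish; the cone at `v` then puts every vertex on the face.
  almost-full-star⇒tight : (z : Fin m → Fin k → ℤ) → (∀ v i → z v i ≢ 0ℤ) →
    (∀ v j → 0ℤ ≡ ℤSum.sum (λ i → z v i ℤ.* (vertex (nbr v i) j ℤ.- vertex v j))) →
    ∀ F v j → Tight F v → (∀ i → i ≢ j → Tight F (nbr v i)) → ∀ w → Tight F w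
  almost-full-star⇒tight z z≢0 relation F v j tight-v tight-i = tight-star⇒tight F v tight-v tight-all
    where
    others≈0 : ∀ i → i ≢ j → ι (z v i) * vertexSlack F (nbr v i) ≈ 0#
    others≈0 i i≢j = trans (*-congˡ (tight-i i i≢j)) (zeroʳ _)
    Σ≈0 : ∑[ i < k ] (ι (z v i) * vertexSlack F (nbr v i)) ≈ 0#
    -- With `v` in place of `w` and the factor 0, the left side vanishes.
    Σ≈0 = trans (sym (tight-combination F v v 0ℤ (z v) (nbr v) (relation v) tight-v)) (zeroˡ _)
    tight-all : ∀ i → Tight F (nbr v i)
    tight-all i with i Fin.≟ j
    ... | no i≢j     = tight-i i i≢j
    ... | yes ≡.refl = *-cancelˡ-≈0 (z≢0 v i ∘ ι≈0⇒≡0 (z v i))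
      (trans (sym (sum-single _ i others≈0)) Σ≈0)

  -- A third vertex `w` would make `w`, `nbr v i` and `v` affinely independent by the triangular
  -- criterion: among these, the edge face is tight at the last two only, the vertex face at the
  -- last only, and the empty face nowhere.
  edge-dim : ∀ F v i w → DimAtMost ℝ 1 (faceSet F) → Tight F v → Tight F (nbr v i) → Tight F w →
             w ≡ v ⊎ w ≡ nbr v i
  edge-dim F v i w dim≤1 tight-v tight-u tight-w with w Fin.≟ v | w Fin.≟ nbr v i
  ... | yes w≡v | _       = inj₁ w≡v
  ... | no _    | yes w≡u = inj₂ w≡u
  ... | no w≢v  | no w≢u  = contradiction (p ∘ x , x∈F , independent) dim≤1
    where
    x : Fin 3 → Fin m
    x zero             = w
    x (suc zero)       = nbr v i
    x (suc (suc zero)) = v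
    x∈F : ∀ l → p (x l) ∈ faceSet F
    x∈F zero             = tight⇒∈ F _ tight-w
    x∈F (suc zero)       = tight⇒∈ F _ tight-u
    x∈F (suc (suc zero)) = tight⇒∈ F _ tight-v
    G : Fin 3 → Face ℝ P
    G zero             = starFace v (suc i)
    G (suc zero)       = vertexFace v
    G (suc (suc zero)) = emptyFace
    above : ∀ l l′ → l Fin.< l′ → Tight (G l) (x l′)
    above zero             (suc zero)       _ = starFace-tight v (suc i) _ (inj₂ ≡.refl)
    above zero             (suc (suc zero)) _ = starFace-tight v (suc i) _ (inj₁ ≡.refl)
    above (suc zero)       (suc (suc zero)) _ = starFace-tight v zero _ (inj₁ ≡.refl)
    above (suc zero)       (suc zero)       (ℕ.s≤s ())
    above (suc (suc zero)) (suc zero)       (ℕ.s≤s ())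
    above (suc (suc zero)) (suc (suc zero)) (ℕ.s≤s (ℕ.s≤s ()))
    diagonal : ∀ l → ¬ Tight (G l) (x l)
    diagonal zero             = [ w≢v , w≢u ]′ ∘ starFace-tight⁻¹ v (suc i) w
    diagonal (suc zero)       = nbr≢ v i ∘ vertexFace-tight⁻¹ v (nbr v i)
    diagonal (suc (suc zero)) = emptyFace-loose v
    independent : AffinelyIndependent ℝ (p ∘ x)
    independent = triangular⇒independent (p ∘ x) (normal ∘ G) (offset ∘ G) above diagonal

  open Shapes nbr

  HasShape : Face ℝ P → Shape → Set ℓ₁
  HasShape F s = (∀ u → Tight F u → u ∈ₛ s) × (∀ u → u ∈ₛ s → Tight F u)

  -- If there are two tight vertices, `tight-neighbour` replaces the second by a neighbour of the
  -- first, and the dimension bound excludes any further vertex.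
  shape : ∀ F → DimAtMost ℝ 1 (faceSet F) → ∃ (HasShape F)
  shape F dim≤1 with Fin.any? (tight? F)
  ... | no none = nothing , (λ u tight-u → none (u , tight-u)) , λ _ ()
  ... | yes (v , tight-v) with Fin.any? (λ w → tight? F w ×-dec ¬? (w Fin.≟ v))
  ...   | no none = just (v , zero) ,
    (λ u tight-u → inj₁ (decidable-stable (u Fin.≟ v) (λ u≢v → none (u , tight-u , u≢v)))) ,
    λ { u (inj₁ ≡.refl) → tight-v ; u (inj₂ ≡.refl) → tight-v }
  ...   | yes (w , tight-w , w≢v) with tight-neighbour F v w tight-v tight-w w≢v
  ...     | i , tight-i = just (v , suc i) ,
    (λ u tight-u → edge-dim F v i u dim≤1 tight-v tight-i tight-u) ,
    λ { u (inj₁ ≡.refl) → tight-v ; u (inj₂ ≡.refl) → tight-i }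

  shapeFace : Shape → Σ[ F ∈ Face ℝ P ] DimAtMost ℝ 1 (faceSet F)
  shapeFace nothing        = emptyFace , λ (x , x∈∅ , _) → emptyFace-empty (x zero) (x∈∅ zero)
  shapeFace (just (v , i)) = starFace v i ,
    dimAtMost-1 (starFace v i) v (star nbr v i) (starFace-tight⁻¹ v i)

  shapeFace-shape : ∀ s → HasShape (proj₁ (shapeFace s)) s
  shapeFace-shape nothing        = (λ u → emptyFace-loose u) , λ _ ()
  shapeFace-shape (just (v , i)) = starFace-tight⁻¹ v i , starFace-tight v i

-- Isomorphism of 1-skeleta with a common graph

module SkeletonIsomorphism {c ℓ₁ ℓ₂} (ℝ : CompleteOrderedField c ℓ₁ ℓ₂)
  {m k n n′} {nbr : Fin m → Fin k → Fin m} (nbr≢ : ∀ v i → nbr v i ≢ v)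
  (R : GraphRealization nbr n) (R′ : GraphRealization nbr n′)
  (p : Fin m → Point ℝ n) (p≈ι : AffineGeometry.Represents ℝ (GraphRealization.vertex R) p)
  (p′ : Fin m → Point ℝ n′) (p′≈ι : AffineGeometry.Represents ℝ (GraphRealization.vertex R′) p′) where

  private
    module P  = RealizedFaces ℝ nbr≢ R p p≈ι
    module P′ = RealizedFaces ℝ nbr≢ R′ p′ p′≈ι

    SameVertices : Face ℝ P.P → Face ℝ P′.P → Set _
    SameVertices F F′ = (∀ u → P.Tight F u → P′.Tight F′ u) × (∀ u → P′.Tight F′ u → P.Tight F u)

    -- A shape depends only on the graph, so it can be read off in one polytope and realized in the
    -- other. This preserves vertex sets, from which all order properties follow.
    to : Poset.Carrier (skeleton ℝ 1 P.P) → Poset.Carrier (skeleton ℝ 1 P′.P)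
    to (F , dim≤1) = P′.shapeFace (proj₁ (P.shape F dim≤1))

    from : Poset.Carrier (skeleton ℝ 1 P′.P) → Poset.Carrier (skeleton ℝ 1 P.P)
    from (F , dim≤1) = P.shapeFace (proj₁ (P′.shape F dim≤1))

    to-same : ∀ F → SameVertices (proj₁ F) (proj₁ (to F))
    to-same (F , dim≤1) =
      let s , F⇒s , s⇒F = P.shape F dim≤1
          F′⇒s , s⇒F′ = P′.shapeFace-shape s
      in (λ u → s⇒F′ u ∘ F⇒s u) , (λ u → s⇒F u ∘ F′⇒s u)

    from-same : ∀ F′ → SameVertices (proj₁ (from F′)) (proj₁ F′)
    from-same (F′ , dim≤1) =
      let s , F′⇒s , s⇒F′ = P′.shape F′ dim≤1
          F⇒s , s⇒F = P.shapeFace-shape s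
      in (λ u → s⇒F′ u ∘ F⇒s u) , (λ u → s⇒F u ∘ F′⇒s u)

    mono : ∀ F G F′ G′ → SameVertices F F′ → SameVertices G G′ → F P.⊑ G → F′ P′.⊑ G′
    mono F G F′ G′ (_ , F′⇒F) (G⇒G′ , _) F⊑G =
      P′.tight⇒⊑ F′ G′ (λ u → G⇒G′ u ∘ P.⊑⇒tight F G F⊑G u ∘ F′⇒F u)

    to-mono : ∀ F G → proj₁ F P.⊑ proj₁ G → proj₁ (to F) P′.⊑ proj₁ (to G)
    to-mono F G = mono (proj₁ F) (proj₁ G) (proj₁ (to F)) (proj₁ (to G)) (to-same F) (to-same G)

    to-cancel : ∀ F G → proj₁ (to F) P′.⊑ proj₁ (to G) → proj₁ F P.⊑ proj₁ G
    to-cancel F G toF⊑toG = P.tight⇒⊑ (proj₁ F) (proj₁ G) (λ u →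
      proj₂ (to-same G) u ∘ P′.⊑⇒tight (proj₁ (to F)) (proj₁ (to G)) toF⊑toG u ∘ proj₁ (to-same F) u)

    to-from : ∀ F G′ → proj₁ F P.⊑ proj₁ (from G′) → proj₁ (to F) P′.⊑ proj₁ G′
    to-from F G′ = mono (proj₁ F) (proj₁ (from G′)) (proj₁ (to F)) (proj₁ G′) (to-same F) (from-same G′)

    from-to : ∀ F G′ → proj₁ (from G′) P.⊑ proj₁ F → proj₁ G′ P′.⊑ proj₁ (to F)
    from-to F G′ = mono (proj₁ (from G′)) (proj₁ F) (proj₁ G′) (proj₁ (to F)) (from-same G′) (to-same F)

  skeleton-≅ : skeleton ℝ 1 P.P ≅ skeleton ℝ 1 P′.P
  skeleton-≅ = to , record
    { isOrderMonomorphism = record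
      { isOrderHomomorphism = record
        { cong = λ {F} {G} (F⊑G , G⊑F) →
            (λ {x} → to-mono F G F⊑G {x}) , (λ {x} → to-mono G F G⊑F {x})
        ; mono = λ {F} {G} F⊑G {x} → to-mono F G F⊑G {x}
        }
      ; injective = λ {F} {G} (F⊑G , G⊑F) →
          (λ {x} → to-cancel F G F⊑G {x}) , (λ {x} → to-cancel G F G⊑F {x})
      ; cancel = λ {F} {G} F⊑G {x} → to-cancel F G F⊑G {x}
      }
    ; surjective = λ G′ → from G′ , λ {F} (F⊑G , G⊑F) →
        (λ {x} → to-from F G′ F⊑G {x}) , (λ {x} → from-to F G′ G⊑F {x})
    }

-- Isomorphisms of face posets

-- Punching out a missed value would leave an injection of `Fin (suc n)` into `Fin n`.
injective⇒surjective : ∀ {n} (f : Fin n → Fin n) → (∀ {i j} → f i ≡ f j → i ≡ j) →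
                       ∀ k → ∃[ i ] f i ≡ k
injective⇒surjective {suc n} f f-injective k with Fin.any? (λ i → f i Fin.≟ k)
... | yes preimage = preimage
... | no missed    = contradiction
  (Fin.injective⇒≤ {f = λ i → Fin.punchOut {i = k} {j = f i} (λ k≡fi → missed (i , ≡.sym k≡fi))}
    (λ eq → f-injective (Fin.punchOut-injective {i = k} _ _ eq)))
  ℕ.1+n≰n

module InclusionIsomorphism {m k f ℓ f′ ℓ′} {nbr : Fin m → Fin (suc k) → Fin m}
  (nbr≢ : ∀ v i → nbr v i ≢ v) (nbr-injective : ∀ v {i j} → nbr v i ≡ nbr v j → i ≡ j)
  (A : FaceIncidence nbr f ℓ) (B : FaceIncidence nbr f′ ℓ′) where

  private
    module A = FaceIncidence A
    module B = FaceIncidence B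

  module _ (to : A.Cell → B.Cell) (from : B.Cell → A.Cell)
    (to-mono : ∀ {F G} → F A.≼ G → to F B.≼ to G)
    (to-cancel : ∀ {F G} → to F B.≼ to G → F A.≼ G)
    (to-from-≼ : ∀ G → to (from G) B.≼ G) (≼-to-from : ∀ G → G B.≼ to (from G)) where

    from-≼ : ∀ {F G} → G B.≼ to F → from G A.≼ F
    from-≼ {G = G} G≼toF = to-cancel (B.≼-trans (to-from-≼ G) G≼toF)

    ≼-from : ∀ {F G} → to F B.≼ G → F A.≼ from G
    ≼-from {G = G} toF≼G = to-cancel (B.≼-trans toF≼G (≼-to-from G))

    from-≼⁻¹ : ∀ {F G} → from G A.≼ F → G B.≼ to F
    from-≼⁻¹ {G = G} fromG≼F = B.≼-trans (≼-to-from G) (to-mono fromG≼F)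

    ≼-from⁻¹ : ∀ {F G} → F A.≼ from G → to F B.≼ G
    ≼-from⁻¹ {G = G} F≼fromG = B.≼-trans (to-mono F≼fromG) (to-from-≼ G)

    -- An image without vertices would lie below the image of every face, so `F` would lie below the
    -- vertex face of a neighbour of `v`, although it contains `v`.
    to-nonempty : ∀ F v → A.Tight F v → ∃ (B.Tight (to F))
    to-nonempty F v tight-v with Fin.any? (B.tight? (to F))
    ... | yes found = found
    ... | no none   = contradiction (A.vertexFace-tight⁻¹ w v (F≼w v tight-v)) (nbr≢ v zero ∘ ≡.sym)
      where
      w = nbr v zero
      F≼w : F A.≼ A.vertexFace w
      F≼w = to-cancel (λ u tight-u → contradiction (u , tight-u) none)

    from-nonempty : ∀ G v → B.Tight G v → ∃ (A.Tight (from G))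
    from-nonempty G v tight-v with Fin.any? (A.tight? (from G))
    ... | yes found = found
    ... | no none   = contradiction (B.vertexFace-tight⁻¹ w v (G≼w v tight-v)) (nbr≢ v zero ∘ ≡.sym)
      where
      w = nbr v zero
      G≼w : G B.≼ B.vertexFace w
      G≼w = B.≼-trans (from-≼⁻¹ {G = G} (λ u tight-u → contradiction (u , tight-u) none))
                      (to-from-≼ (B.vertexFace w))

    -- Vertices are the minimal nonempty faces: a vertex `v′` of the image of `v` pulls back to a
    -- nonempty face below `v`, which therefore contains `v`.
    vertex-image : ∀ v → ∃[ v′ ] B.vertexFace v′ B.≼ to (A.vertexFace v) × to (A.vertexFace v) B.≼ B.vertexFace v′
    vertex-image v with to-nonempty (A.vertexFace v) v (A.vertexFace-tight v)
    ... | v′ , tight-v′ with from-nonempty (B.vertexFace v′) v′ (B.vertexFace-tight v′)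
    ...   | u , tight-u = v′ , v′≼toV , ≼-from⁻¹ (A.vertexFace-≼ (≡.subst (A.Tight _) u≡v tight-u))
      where
      v′≼toV : B.vertexFace v′ B.≼ to (A.vertexFace v)
      v′≼toV = B.vertexFace-≼ tight-v′
      u≡v : u ≡ v
      u≡v = A.vertexFace-tight⁻¹ v u (from-≼ v′≼toV u tight-u)

    module _ (v v′ : Fin m) (v′≼toV : B.vertexFace v′ B.≼ to (A.vertexFace v))
      (toV≼v′ : to (A.vertexFace v) B.≼ B.vertexFace v′) where

      private
        V  = A.vertexFace v
        V′ = B.vertexFace v′

      tight-v′ : ∀ {F} → A.Tight F v → B.Tight (to F) v′
      tight-v′ tight-v = B.≼-trans v′≼toV (to-mono (A.vertexFace-≼ tight-v)) v′ (B.vertexFace-tight v′)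

      -- The image of the edge contains `v′` and a second vertex, as otherwise the edge would lie
      -- below `v`; so it contains an edge at `v′`. That edge pulls back to a face below the given
      -- edge that contains `v` and is not `v` alone, hence both ends.
      edge-image : ∀ i → ∃[ l ] B.starFace v′ (suc l) B.≼ to (A.starFace v (suc i)) ×
                                to (A.starFace v (suc i)) B.≼ B.starFace v′ (suc l)
      edge-image i with B.≼-vertexFace? (to (A.starFace v (suc i))) v′
      ... | inj₂ toE≼V′ = contradiction
        (A.vertexFace-tight⁻¹ v (nbr v i) (to-cancel (B.≼-trans toE≼V′ v′≼toV) (nbr v i)
          (A.starFace-tight-star v (suc i))))
        (nbr≢ v i)
      ... | inj₁ (w , tight-w , w≢v′)
          with B.tight-neighbour _ v′ w (tight-v′ (A.starFace-tight-self v (suc i))) tight-w w≢v′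
      ...   | l , tight-l = l , E′≼toE , ≼-from⁻¹ (A.starFace-≼ tight-v tight-i)
        where
        E  = A.starFace v (suc i)
        E′ = B.starFace v′ (suc l)
        G  = from E′
        E′≼toE : E′ B.≼ to E
        E′≼toE = B.starFace-≼ (tight-v′ (A.starFace-tight-self v (suc i))) tight-l
        tight-v : A.Tight G v
        tight-v = ≼-from (B.≼-trans toV≼v′ (B.vertexFace-≼ (B.starFace-tight-self v′ (suc l))))
                         v (A.vertexFace-tight v)
        tight-i : A.Tight G (nbr v i)
        tight-i with A.≼-vertexFace? G v
        ... | inj₂ G≼V = contradiction
          (B.vertexFace-tight⁻¹ v′ (nbr v′ l)
            (B.≼-trans (from-≼⁻¹ G≼V) toV≼v′ (nbr v′ l) (B.starFace-tight-star v′ (suc l))))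
          (nbr≢ v′ l)
        ... | inj₁ (u , tight-u , u≢v) with A.starFace-tight⁻¹ v (suc i) u (from-≼ E′≼toE u tight-u)
        ...   | inj₁ u≡v    = contradiction u≡v u≢v
        ...   | inj₂ ≡.refl = tight-u

      neighbour : Fin (suc k) → Fin (suc k)
      neighbour i = proj₁ (edge-image i)

      neighbour-injective : ∀ {i j} → neighbour i ≡ neighbour j → i ≡ j
      neighbour-injective {i} {j} eq with A.starFace-tight⁻¹ v (suc j) (nbr v i)
        (to-cancel Eᵢ≼Eⱼ (nbr v i) (A.starFace-tight-star v (suc i)))
        where
        Eᵢ≼Eⱼ : to (A.starFace v (suc i)) B.≼ to (A.starFace v (suc j))
        Eᵢ≼Eⱼ = B.≼-trans (proj₂ (proj₂ (edge-image i)))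
          (≡.subst (λ l → B.starFace v′ (suc l) B.≼ to (A.starFace v (suc j))) (≡.sym eq)
            (proj₁ (proj₂ (edge-image j))))
      ... | inj₁ i≡v = contradiction i≡v (nbr≢ v i)
      ... | inj₂ i≡j = nbr-injective v i≡j

      -- `neighbour` permutes the edge indices, so `l` comes from some `i` other than `j`, and the
      -- edge with index `i` lies in `F`.
      tight-neighbours : ∀ F j → A.Tight F v → (∀ i → i ≢ j → A.Tight F (nbr v i)) →
                         ∀ l → l ≢ neighbour j → B.Tight (to F) (nbr v′ l)
      tight-neighbours F j tight-v tight-i l l≢j with injective⇒surjective neighbour neighbour-injective l
      ... | i , ≡.refl = B.≼-trans (proj₁ (proj₂ (edge-image i)))
        (to-mono (A.starFace-≼ tight-v (tight-i i (λ { ≡.refl → l≢j ≡.refl }))))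
        (nbr v′ l) (B.starFace-tight-star v′ (suc l))

    -- The property `full` is pulled back from `B` to `A`: it gives the image of `F` all vertices,
    -- so this image lies above that of every vertex face, and `to-cancel` reflects the inclusion.
    almost-full-star : (∀ G v j → B.Tight G v → (∀ i → i ≢ j → B.Tight G (nbr v i)) → ∀ w → B.Tight G w) →
      ∀ F v j → A.Tight F v → (∀ i → i ≢ j → A.Tight F (nbr v i)) → ∀ w → A.Tight F w
    almost-full-star full F v j tight-v tight-i w =
      let v′ , v′≼toV , toV≼v′ = vertex-image v
          tight-all = full (to F) v′ (neighbour v v′ v′≼toV toV≼v′ j)
            (tight-v′ v v′ v′≼toV toV≼v′ tight-v) (tight-neighbours v v′ v′≼toV toV≼v′ F j tight-v tight-i)
      in to-cancel {A.vertexFace w} {F} (λ u _ → tight-all u) w (A.vertexFace-tight w)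

-- The 5-cube graph and its realizations

-- The vertices of the 5-cube are numbered by their binary digits, most significant digit first.
digits : Fin 32 → Fin 5 → Fin 2
digits = finToFun {2} {5}

flipDigit : Fin 32 → Fin 5 → Fin 32
flipDigit v i = funToFin (updateAt (digits v) i opposite)

abstract
  flipDigit≢ : ∀ v i → flipDigit v i ≢ v
  flipDigit≢ = from-yes (Fin.all? λ v → Fin.all? λ i → ¬? (flipDigit v i Fin.≟ v))

  flipDigit-injective : ∀ v i j → flipDigit v i ≡ flipDigit v j → i ≡ j
  flipDigit-injective = from-yes (Fin.all? λ v → Fin.all? λ i → Fin.all? λ j →
    (flipDigit v i Fin.≟ flipDigit v j) →-dec (i Fin.≟ j))

module Certificate {n} (vertex : Fin 32 → Vec ℤ n) (starNormal : Fin 32 → Fin 6 → Vec ℤ n)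
  (coefficients : Fin 32 → Fin 32 → ℕ × Vec ℕ 5) (directions : Vec (Fin 5) n) where

  simplex : Fin (suc n) → Fin 32
  simplex = lookup (Vec.map (flipDigit zero) directions ∷ʳ zero)

  -- The functionals of the triangular criterion are the coordinates, compared with those of vertex
  -- 0. The last one, for vertex 0 itself, is zero with offset 1.
  unit : Fin (suc n) → Fin n → ℤ
  unit i j = if does (toℕ i ℕ.≟ toℕ j) then + 1 else 0ℤ

  offset : Fin (suc n) → ℤ
  offset = lookup (vertex zero ∷ʳ + 1)

  ConeAt : (x y : Vec ℤ n) → Vec (Vec ℤ n) 5 → ℕ × Vec ℕ 5 → Set
  ConeAt x y xs (d , c) = ∀ j → + suc d ℤ.* (lookup y j ℤ.- lookup x j) ≡
    ℤSum.sum (λ i → + lookup c i ℤ.* (lookup (lookup xs i) j ℤ.- lookup x j))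

  StrictAt : Vec ℤ n → ℤ → Fin 32 → Fin 32 → Set
  StrictAt a b v s = ∀ u → u ≡ v ⊎ u ≡ s ⊎ dotℤ (lookup a) (lookup (vertex u)) ℤ.< b

  Valid : Set
  Valid =
    (∀ v i → dotℤ (lookup (starNormal v i)) (lookup (vertex (star flipDigit v i))) ≡
             dotℤ (lookup (starNormal v i)) (lookup (vertex v))) ×
    (∀ v i → StrictAt (starNormal v i) (dotℤ (lookup (starNormal v i)) (lookup (vertex v)))
                      v (star flipDigit v i)) ×
    (∀ v w → ConeAt (vertex v) (vertex w) (tabulate (vertex ∘ flipDigit v)) (coefficients v w)) ×
    (∀ v w → w ≡ v ⊎ ∃[ i ] lookup (proj₂ (coefficients v w)) i ≢ 0) ×
    (∀ i j → i Fin.< j → dotℤ (unit i) (lookup (vertex (simplex j))) ≡ offset i) ×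
    (∀ i → dotℤ (unit i) (lookup (vertex (simplex i))) ≢ offset i)

  -- strictAt? and coneAt? take their data as arguments so that evaluation shares it.
  valid? : Dec Valid
  valid? =
    (Fin.all? λ v → Fin.all? λ i → _ ℤ.≟ _) ×-dec
    (Fin.all? λ v → Fin.all? λ i → strictAt? (starNormal v i) _ v (star flipDigit v i)) ×-dec
    (Fin.all? λ v → Fin.all? λ w →
      coneAt? (vertex v) (vertex w) (tabulate (vertex ∘ flipDigit v)) (coefficients v w)) ×-dec
    (Fin.all? λ v → Fin.all? λ w → (w Fin.≟ v) ⊎-dec Fin.any? λ i → ¬? (_ ℕ.≟ 0)) ×-dec
    (Fin.all? λ i → Fin.all? λ j → (i Fin.<? j) →-dec (_ ℤ.≟ _)) ×-dec
    (Fin.all? λ i → ¬? (_ ℤ.≟ _))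
    where
    strictAt? : ∀ a b v s → Dec (StrictAt a b v s)
    strictAt? a b v s = Fin.all? λ u → (u Fin.≟ v) ⊎-dec ((u Fin.≟ s) ⊎-dec (_ ℤ.<? b))
    coneAt? : ∀ x y xs dc → Dec (ConeAt x y xs dc)
    coneAt? x y xs dc = Fin.all? λ j → _ ℤ.≟ _

  realization : Valid → GraphRealization flipDigit n
  realization (tight , strict , cones , nonzero , above , diagonal) = record
    { vertex            = lookup ∘ vertex
    ; starNormal        = λ v i → lookup (starNormal v i)
    ; starNormal-tight  = tight
    ; starNormal-strict = strict
    ; scale             = λ v w → proj₁ (coefficients v w)
    ; coeff             = λ v w → lookup (proj₂ (coefficients v w))
    ; cone              = λ v w j → ≡.trans (cones v w j) (ℤSum.sum-cong-≗ (λ i →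
        ≡.cong (λ x → + lookup (proj₂ (coefficients v w)) i ℤ.* (lookup x j ℤ.- lookup (vertex v) j))
               (Vec.lookup∘tabulate (vertex ∘ flipDigit v) i)))
    ; coeff≢0           = nonzero
    ; simplex           = simplex
    ; simplexNormal     = unit
    ; simplexOffset     = offset
    ; simplex-above     = above
    ; simplex-diagonal  = diagonal
    }

-- Coordinates and certificates of the three polytopes

sign : Fin 2 → ℤ
sign zero    = + 1
sign (suc _) = -[1+ 0 ]

-- Polytopes with the vertices (x , y , ±h , ±h) for (x , y , h) in base. An entry (a , b , w , e) of
-- facets stands for the inequalities a x + b y ± w z ≤ e with z the third or the fourth coordinate.
-- The entry (d , c₀ , c₁ , c₂ , c₃) of cones for base points v and w expresses d (w - v), with all
-- signs positive, by the edges at v, where c₃ belongs to both sign changes.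
module Reflected (base : Vec (ℤ × ℤ × ℤ) 8) (facets : List (ℤ × ℤ × ℤ × ℤ))
  (cones : Vec (Vec (ℕ × ℕ × ℕ × ℕ × ℕ) 8) 8) where

  -- Digits 0 to 2 select the base point, and digits 3 and 4 the two signs.
  vertex : Fin 32 → Vec ℤ 4
  vertex v =
    let a , st = remQuot {8} 4 v
        s , t = remQuot {2} 2 st
        x , y , h = lookup base a
    in x ∷ y ∷ sign s ℤ.* h ∷ sign t ℤ.* h ∷ []

  halfSpaces : List (Vec ℤ 4 × ℤ)
  halfSpaces = concatMap
    (λ (a , b , w , e) →
      (a ∷ b ∷ w ∷ 0ℤ ∷ [] , e) ∷ (a ∷ b ∷ ℤ.- w ∷ 0ℤ ∷ [] , e) ∷
      (a ∷ b ∷ 0ℤ ∷ w ∷ [] , e) ∷ (a ∷ b ∷ 0ℤ ∷ ℤ.- w ∷ [] , e) ∷ [])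
    facets

  -- A sum of valid inequalities is tight exactly where all of them are, so it exposes their common
  -- face. That no unexpected vertex lies on it is checked in `Valid`.
  tightNormals : Vec ℤ 4 → Vec ℤ 4 → Vec ℤ 4
  tightNormals x y = List.foldr
    (λ (a , e) acc → if does (dotℤ (lookup a) (lookup x) ℤ.≟ e) ∧ does (dotℤ (lookup a) (lookup y) ℤ.≟ e)
                     then zipWith ℤ._+_ a acc else acc)
    (replicate 4 0ℤ) halfSpaces

  -- Let v have height h and w height h′. If they differ in the sign of a coordinate, then changing
  -- that sign gives v′ and w′ with h (w - v) = h′ (v′ - v) + h (w′ - v).
  coefficients : Fin 32 → Fin 32 → ℕ × Vec ℕ 5
  coefficients v w =
    let a , st = remQuot {8} 4 v
        s , t = remQuot {2} 2 st
        a′ , st′ = remQuot {8} 4 w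
        s′ , t′ = remQuot {2} 2 st′
        h  = ℤ.∣ proj₂ (proj₂ (lookup base a)) ∣
        h′ = ℤ.∣ proj₂ (proj₂ (lookup base a′)) ∣
        d , c₀ , c₁ , c₂ , c₃ = lookup (lookup cones a) a′
        reflection : Fin 2 → Fin 2 → ℕ
        reflection s s′ = if does (s Fin.≟ s′) then 0 else h′ ℕ.* d
    -- `ConeAt` adds 1 to the stored factor, which makes it positive.
    in ℕ.pred (h ℕ.* d) , h ℕ.* c₀ ∷ h ℕ.* c₁ ∷ h ℕ.* c₂ ∷
       h ℕ.* c₃ ℕ.+ reflection s s′ ∷ h ℕ.* c₃ ℕ.+ reflection t t′ ∷ []

  starNormal : Fin 32 → Fin 6 → Vec ℤ 4
  starNormal v i = tightNormals (vertex v) (vertex (star flipDigit v i))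

-- At vertex 0 of both 4-polytopes, the first coordinates changed by these flips are 0, 1, 2, 3 in
-- turn, which makes the simplex triangular.
directions : Vec (Fin 5) 4
directions = # 0 ∷ # 1 ∷ # 3 ∷ # 4 ∷ []

-- The convex hull of all (±2 , ±2 , ±1 , ±1) and (±1 , ±1 , ±2 , ±2), whose 24 facets are 3-cubes.
module Cubical where
  open import Data.Integer.Base using (-_)

  base : Vec (ℤ × ℤ × ℤ) 8
  base =
    (+ 2 , + 2 , + 1) ∷ (+ 1 , + 1 , + 2) ∷
    (+ 2 , - + 2 , + 1) ∷ (+ 1 , - + 1 , + 2) ∷
    (- + 2 , + 2 , + 1) ∷ (- + 1 , + 1 , + 2) ∷
    (- + 2 , - + 2 , + 1) ∷ (- + 1 , - + 1 , + 2) ∷ []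

  facets : List (ℤ × ℤ × ℤ × ℤ)
  facets =
    (+ 1 , + 0 , + 0 , + 2) ∷ (- + 1 , + 0 , + 0 , + 2) ∷ (+ 0 , + 1 , + 0 , + 2) ∷
    (+ 0 , - + 1 , + 0 , + 2) ∷ (+ 0 , + 0 , + 1 , + 2) ∷ (+ 1 , + 0 , + 1 , + 3) ∷
    (- + 1 , + 0 , + 1 , + 3) ∷ (+ 0 , + 1 , + 1 , + 3) ∷ (+ 0 , - + 1 , + 1 , + 3) ∷ []

  cones : Vec (Vec (ℕ × ℕ × ℕ × ℕ × ℕ) 8) 8
  cones =
    ((1 , 0 , 0 , 0 , 0) ∷ (1 , 0 , 0 , 1 , 0) ∷ (1 , 0 , 1 , 0 , 0) ∷ (2 , 0 , 1 , 2 , 0) ∷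
     (1 , 1 , 0 , 0 , 0) ∷ (2 , 1 , 0 , 2 , 0) ∷ (1 , 1 , 1 , 0 , 0) ∷ (1 , 0 , 0 , 3 , 1) ∷ []) ∷
    ((1 , 0 , 0 , 1 , 0) ∷ (1 , 0 , 0 , 0 , 0) ∷ (1 , 0 , 2 , 1 , 0) ∷ (1 , 0 , 1 , 0 , 0) ∷
     (1 , 2 , 0 , 1 , 0) ∷ (1 , 1 , 0 , 0 , 0) ∷ (1 , 2 , 2 , 1 , 0) ∷ (1 , 1 , 1 , 0 , 0) ∷ []) ∷
    ((1 , 0 , 1 , 0 , 0) ∷ (2 , 0 , 1 , 2 , 0) ∷ (1 , 0 , 0 , 0 , 0) ∷ (1 , 0 , 0 , 1 , 0) ∷
     (1 , 1 , 1 , 0 , 0) ∷ (1 , 0 , 0 , 3 , 1) ∷ (1 , 1 , 0 , 0 , 0) ∷ (2 , 1 , 0 , 2 , 0) ∷ []) ∷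
    ((1 , 0 , 2 , 1 , 0) ∷ (1 , 0 , 1 , 0 , 0) ∷ (1 , 0 , 0 , 1 , 0) ∷ (1 , 0 , 0 , 0 , 0) ∷
     (1 , 2 , 2 , 1 , 0) ∷ (1 , 1 , 1 , 0 , 0) ∷ (1 , 2 , 0 , 1 , 0) ∷ (1 , 1 , 0 , 0 , 0) ∷ []) ∷
    ((1 , 1 , 0 , 0 , 0) ∷ (2 , 1 , 0 , 2 , 0) ∷ (1 , 1 , 1 , 0 , 0) ∷ (1 , 0 , 0 , 3 , 1) ∷
     (1 , 0 , 0 , 0 , 0) ∷ (1 , 0 , 0 , 1 , 0) ∷ (1 , 0 , 1 , 0 , 0) ∷ (2 , 0 , 1 , 2 , 0) ∷ []) ∷
    ((1 , 2 , 0 , 1 , 0) ∷ (1 , 1 , 0 , 0 , 0) ∷ (1 , 2 , 2 , 1 , 0) ∷ (1 , 1 , 1 , 0 , 0) ∷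
     (1 , 0 , 0 , 1 , 0) ∷ (1 , 0 , 0 , 0 , 0) ∷ (1 , 0 , 2 , 1 , 0) ∷ (1 , 0 , 1 , 0 , 0) ∷ []) ∷
    ((1 , 1 , 1 , 0 , 0) ∷ (1 , 0 , 0 , 3 , 1) ∷ (1 , 1 , 0 , 0 , 0) ∷ (2 , 1 , 0 , 2 , 0) ∷
     (1 , 0 , 1 , 0 , 0) ∷ (2 , 0 , 1 , 2 , 0) ∷ (1 , 0 , 0 , 0 , 0) ∷ (1 , 0 , 0 , 1 , 0) ∷ []) ∷
    ((1 , 2 , 2 , 1 , 0) ∷ (1 , 1 , 1 , 0 , 0) ∷ (1 , 2 , 0 , 1 , 0) ∷ (1 , 1 , 0 , 0 , 0) ∷
     (1 , 0 , 2 , 1 , 0) ∷ (1 , 0 , 1 , 0 , 0) ∷ (1 , 0 , 0 , 1 , 0) ∷ (1 , 0 , 0 , 0 , 0) ∷ []) ∷ []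

  open Reflected base facets cones public
  open Certificate vertex starNormal coefficients directions public

  abstract
    valid : Valid
    valid = from-yes valid?

  -- At (2, 2, 1, 1) the oblique edge is (-1, -1, 1, 1), and the other edges are -4, -4, -2, -2
  -- times the unit vectors; they cancel four times the oblique edge. At (1, 1, 2, 2) the roles of
  -- the two coordinate pairs are exchanged, and sign symmetry gives the other vertices.
  relation : Fin 32 → Fin 5 → ℤ
  relation v = lookup (if does (digits v (# 2) Fin.≟ zero)
    then - + 1 ∷ - + 1 ∷ + 4 ∷ + 2 ∷ + 2 ∷ []
    else + 2 ∷ + 2 ∷ + 4 ∷ - + 1 ∷ - + 1 ∷ [])

  relation≢0 : ∀ v i → relation v i ≢ 0ℤ
  relation≢0 = toWitness {a? = Fin.all? λ v → Fin.all? λ i → ¬? (_ ℤ.≟ _)} _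

  relation-holds : ∀ v j → 0ℤ ≡ ℤSum.sum (λ i → relation v i ℤ.*
                   (lookup (vertex (flipDigit v i)) j ℤ.- lookup (vertex v) j))
  relation-holds = toWitness {a? = Fin.all? λ v → Fin.all? λ j → _ ℤ.≟ _} _

-- Here the base points of height at most 3 are (0 , ±2 , 1), (6 , 0 , 1) and (0 , 0 , 3). The last
-- lies above the segment between the first two, which flattens two adjacent 3-cubes into the facet
-- x = 0 with 12 vertices.
module Bulged where
  open import Data.Integer.Base using (-_)

  base : Vec (ℤ × ℤ × ℤ) 8
  base =
    (+ 0 , - + 2 , + 1) ∷ (+ 2 , - + 1 , + 4) ∷
    (+ 0 , + 0 , + 3) ∷ (+ 1 , + 0 , + 4) ∷
    (+ 6 , + 0 , + 1) ∷ (+ 5 , + 0 , + 4) ∷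
    (+ 0 , + 2 , + 1) ∷ (+ 2 , + 1 , + 4) ∷ []

  facets : List (ℤ × ℤ × ℤ × ℤ)
  facets =
    (- + 1 , + 0 , + 0 , + 0) ∷ (+ 1 , + 3 , + 0 , + 6) ∷ (+ 1 , - + 3 , + 0 , + 6) ∷
    (+ 0 , + 0 , + 1 , + 4) ∷ (- + 1 , - + 1 , + 1 , + 3) ∷ (- + 1 , + 1 , + 1 , + 3) ∷
    (+ 3 , + 9 , + 1 , + 19) ∷ (+ 3 , - + 9 , + 1 , + 19) ∷ []

  cones : Vec (Vec (ℕ × ℕ × ℕ × ℕ × ℕ) 8) 8
  cones =
    ((1 , 0 , 0 , 0 , 0) ∷ (1 , 0 , 0 , 1 , 0) ∷ (1 , 0 , 1 , 0 , 0) ∷ (4 , 0 , 3 , 2 , 0) ∷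
     (1 , 1 , 0 , 0 , 0) ∷ (2 , 1 , 0 , 2 , 0) ∷ (1 , 0 , 2 , 0 , 2) ∷ (1 , 0 , 1 , 1 , 1) ∷ []) ∷
    ((1 , 0 , 0 , 1 , 0) ∷ (1 , 0 , 0 , 0 , 0) ∷ (3 , 0 , 4 , 1 , 0) ∷ (1 , 0 , 1 , 0 , 0) ∷
     (1 , 2 , 0 , 1 , 0) ∷ (1 , 1 , 0 , 0 , 0) ∷ (1 , 1 , 3 , 1 , 0) ∷ (2 , 1 , 3 , 0 , 0) ∷ []) ∷
    ((1 , 0 , 1 , 0 , 0) ∷ (2 , 0 , 1 , 4 , 0) ∷ (1 , 0 , 0 , 0 , 0) ∷ (1 , 0 , 0 , 1 , 0) ∷
     (1 , 2 , 2 , 6 , 0) ∷ (1 , 1 , 1 , 5 , 0) ∷ (1 , 1 , 0 , 0 , 0) ∷ (2 , 1 , 0 , 4 , 0) ∷ []) ∷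
    ((1 , 0 , 2 , 3 , 0) ∷ (1 , 0 , 1 , 0 , 0) ∷ (1 , 0 , 0 , 1 , 0) ∷ (1 , 0 , 0 , 0 , 0) ∷
     (1 , 4 , 4 , 3 , 0) ∷ (1 , 2 , 2 , 0 , 0) ∷ (1 , 2 , 0 , 3 , 0) ∷ (1 , 1 , 0 , 0 , 0) ∷ []) ∷
    ((1 , 1 , 0 , 0 , 0) ∷ (2 , 1 , 0 , 2 , 0) ∷ (1 , 0 , 0 , 6 , 8) ∷ (1 , 0 , 0 , 5 , 6) ∷
     (1 , 0 , 0 , 0 , 0) ∷ (1 , 0 , 0 , 1 , 0) ∷ (1 , 0 , 1 , 0 , 0) ∷ (2 , 0 , 1 , 2 , 0) ∷ []) ∷
    ((1 , 2 , 0 , 1 , 0) ∷ (1 , 1 , 0 , 0 , 0) ∷ (9 , 8 , 8 , 3 , 0) ∷ (3 , 2 , 2 , 0 , 0) ∷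
     (1 , 0 , 0 , 1 , 0) ∷ (1 , 0 , 0 , 0 , 0) ∷ (1 , 0 , 2 , 1 , 0) ∷ (1 , 0 , 1 , 0 , 0) ∷ []) ∷
    ((1 , 2 , 0 , 0 , 2) ∷ (1 , 1 , 0 , 1 , 1) ∷ (1 , 1 , 0 , 0 , 0) ∷ (4 , 3 , 0 , 2 , 0) ∷
     (1 , 0 , 1 , 0 , 0) ∷ (2 , 0 , 1 , 2 , 0) ∷ (1 , 0 , 0 , 0 , 0) ∷ (1 , 0 , 0 , 1 , 0) ∷ []) ∷
    ((1 , 3 , 1 , 1 , 0) ∷ (2 , 3 , 1 , 0 , 0) ∷ (3 , 4 , 0 , 1 , 0) ∷ (1 , 1 , 0 , 0 , 0) ∷
     (1 , 0 , 2 , 1 , 0) ∷ (1 , 0 , 1 , 0 , 0) ∷ (1 , 0 , 0 , 1 , 0) ∷ (1 , 0 , 0 , 0 , 0) ∷ []) ∷ []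

  open Reflected base facets cones public
  open Certificate vertex starNormal coefficients directions public

  abstract
    valid : Valid
    valid = from-yes valid?

  left : Fin 4 → ℤ
  left = lookup (- + 1 ∷ 0ℤ ∷ 0ℤ ∷ 0ℤ ∷ [])

  left-valid : ∀ u → dotℤ left (lookup (vertex u)) ≡ 0ℤ ⊎ dotℤ left (lookup (vertex u)) ℤ.< 0ℤ
  left-valid = toWitness {a? = Fin.all? λ u → (_ ℤ.≟ _) ⊎-dec (_ ℤ.<? _)} _

  -- Vertex 8 is (0 , 0 , 3 , 3).
  left-neighbours : ∀ i → i ≢ # 2 → dotℤ left (lookup (vertex (flipDigit (# 8) i))) ≡ 0ℤ
  left-neighbours = toWitness {a? = Fin.all? λ i → ¬? (i Fin.≟ # 2) →-dec (_ ℤ.≟ _)} _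

module Cube where
  vertex : Fin 32 → Vec ℤ 5
  vertex v = tabulate λ j → + toℕ (digits v j)

  -- A coordinate where both ends agree gets -2 for the digit 0 and 2 for the digit 1, and a flipped
  -- one gets 0. Hence the maximum on the cube's vertices is attained at the two ends only.
  starNormal : Fin 32 → Fin 6 → Vec ℤ 5
  starNormal v i = tabulate λ j → ℤ.- (sign (digits v j) ℤ.+ sign (digits (star flipDigit v i) j))

  -- In the cube, `w - v` is the sum of the edges at `v` for the digits that differ; the stored 0
  -- encodes the factor 1.
  coefficients : Fin 32 → Fin 32 → ℕ × Vec ℕ 5
  coefficients v w = 0 , tabulate λ i → if does (digits v i Fin.≟ digits w i) then 0 else 1

  open Certificate vertex starNormal coefficients (allFin 5) public

  abstract
    valid : Valid
    valid = from-yes valid?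

-- Ambiguity of the graph of the 5-cube

module FiveCubeAmbiguity {c ℓ₁ ℓ₂} (ℝ : CompleteOrderedField c ℓ₁ ℓ₂) where

  open CompleteOrderedField ℝ hiding (zero)
  open OrderedFieldProperties ℝ
  open AffineGeometry ℝ

  points : ∀ {n} → (Fin 32 → Vec ℤ n) → Fin 32 → Point ℝ n
  points vertex v j = ι (lookup (vertex v) j)

  bulged = Bulged.realization Bulged.valid
  cubical = Cubical.realization Cubical.valid
  fiveCube = Cube.realization Cube.valid

  cube-represents : Represents (lookup ∘ Cube.vertex) (Polytope.points (cube ℝ 5))
  cube-represents v j = trans (bit≈ι (digits v j))
    (reflexive (≡.cong ι (≡.sym (Vec.lookup∘tabulate (λ j → + toℕ (digits v j)) j))))
    where
    bit≈ι : ∀ b → bit ℝ b ≈ ι (+ toℕ b)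
    bit≈ι zero       = refl
    bit≈ι (suc zero) = sym (+-identityʳ 1#)

  module B = RealizedFaces ℝ flipDigit≢ bulged (points Bulged.vertex) (λ _ _ → refl)
  module C = RealizedFaces ℝ flipDigit≢ cubical (points Cubical.vertex) (λ _ _ → refl)
  module I = RealizedFaces ℝ flipDigit≢ fiveCube (Polytope.points (cube ℝ 5)) cube-represents

  B≄C : ¬ CombinatoriallyEquivalent ℝ B.P C.P
  -- Vertex 4 is (2, -1, 4, 4), off the facet x = 0, but the isomorphism would put every vertex on
  -- that facet.
  B≄C (f , iso) = B.slack≉0 Bulged.left 0ℤ (# 4) (λ ())
    (InclusionIsomorphism.almost-full-star flipDigit≢ (λ v → flipDigit-injective v _ _) B.incidence C.incidence f from
      (λ {F} {G} F≼G u → C.⊑⇒tight (f F) (f G) (mono {F} {G} (B.tight⇒⊑ F G F≼G)) u)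
      (λ {F} {G} fF≼fG u → B.⊑⇒tight F G (cancel {F} {G} (C.tight⇒⊑ (f F) (f G) fF≼fG)) u)
      (λ G → C.⊑⇒tight (f (from G)) G (proj₁ (f-from G)))
      (λ G → C.⊑⇒tight G (f (from G)) (proj₂ (f-from G)))
      (C.almost-full-star⇒tight Cubical.relation Cubical.relation≢0 Cubical.relation-holds)
      left (# 8) (# 2) (B.slack≈0 Bulged.left 0ℤ (# 8) ≡.refl)
      (λ i i≢2 → B.slack≈0 Bulged.left 0ℤ (flipDigit (# 8) i) (Bulged.left-neighbours i i≢2))
      (# 4))
    where
    left : Face ℝ B.P
    left = B.latticeFace Bulged.left 0ℤ Bulged.left-valid
    open IsOrderIsomorphism iso using (mono; cancel; surjective)
    from : Face ℝ C.P → Face ℝ B.P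
    from G = proj₁ (surjective G)
    f-from : ∀ G → Poset._≈_ (facePoset ℝ C.P) (f (from G)) G
    f-from G = proj₂ (surjective G) {from G} ((λ {x} → id) , (λ {x} → id))

mainTheorem5 : ∀ {c ℓ₁ ℓ₂} (ℝ : CompleteOrderedField c ℓ₁ ℓ₂) →
    StronglyAmbiguous ℝ 1 4 (skeleton ℝ 1 (cube ℝ 5))
mainTheorem5 ℝ =
  B.P , 5 , cube ℝ 5 , C.P ,
  B.hasDim , I.hasDim , ℕ.n<1+n 4 ,
  skeleton-≅ ℝ flipDigit≢ bulged fiveCube _ (λ _ _ → refl) _ cube-represents ,
  -- The reflexive case is an instance of the same construction.
  skeleton-≅ ℝ flipDigit≢ fiveCube fiveCube _ cube-represents _ cube-represents ,
  C.hasDim , B≄C ,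
  skeleton-≅ ℝ flipDigit≢ cubical fiveCube _ (λ _ _ → refl) _ cube-represents
  where
  open CompleteOrderedField ℝ using (refl)
  open FiveCubeAmbiguity ℝ
  open SkeletonIsomorphism
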